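{- Let $L(n)$ denote the maximum CF-chromatic number $\chi_{\mathrm{cf}}(G)$ over all intersection graphs $G$ of families of at most $n$ grounded L-shapes. Then $\Omega(\log n)\le L(n)\le O(\log^3 n)$.
   Context: An L-shape is a curve consisting of a vertical segment and a horizontal segment forming the letter L, i.e. a set of the form $\{x\}\times[y_0,y_1]\ \cup\ [x,x']\times\{y_0\}$ with $y_0<y_1$, $x<x'$. Fix a horizontal line $H$ (the baseline). An L-shape is grounded if it lies in the closed lower halfplane bounded by $H$ and has exactly one endpoint (the top of its vertical segment) on $H$. The intersection graph of a family of sets has the sets as vertices, two adjacent iff they intersect. For a graph $G=(V,E)$ and $v\in V$, $N_G(v)=\{u:\{u,v\}\in E\}$. A CF-coloring of $G$ is a map $c:V\to\mathbb{N}$ such that for every $v$ with $N_G(v)\ne\emptyset$ some color appears exactly once in $N_G(v)$ (vertices with empty neighborhood impose no condition); $\chi_{\mathrm{cf}}(G)$ is the minimum number of colors in such a coloring.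
   Formalization: The coordinates of the L-shapes and the height of the baseline H are rational numbers instead of real numbers. -}

module Defs where

open import Data.Nat as ℕ using (ℕ; _^_; _*_)
open import Data.Nat.Logarithm using (⌊log₂_⌋)
open import Data.Rational using (ℚ; _≤_; _<_)
open import Data.Fin using (Fin)
open import Data.Product using (Σ; ∃; _×_)
open import Data.Sum using (_⊎_)
open import Relation.Binary.PropositionalEquality using (_≡_)
open import Relation.Nullary using (¬_)

-- An L-shape  {x} × [y₀,y₁]  ∪  [x,x'] × {y₀}  with y₀ < y₁ and x < x'.
-- Coordinates are rational.
record LShape : Set where
  field
    x x' y₀ y₁ : ℚ
    y₀<y₁ : y₀ < y₁
    x<x'  : x < x'
open LShape public

_∈L_ : ℚ × ℚ → LShape → Set
(p Data.Product., q) ∈L L =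
  (p ≡ x L × (y₀ L ≤ q × q ≤ y₁ L)) ⊎ ((x L ≤ p × p ≤ x' L) × q ≡ y₀ L)

-- Grounded with respect to the baseline y = h: the L-shape lies in the closed
-- lower halfplane y ≤ h and exactly one of its endpoints, the top (x , y₁) of the
-- vertical segment, lies on the baseline (the other endpoint (x' , y₀) does not).
Grounded : ℚ → LShape → Set
Grounded h L = y₁ L ≡ h × ¬ (y₀ L ≡ h) × (∀ P → P ∈L L → Data.Product.proj₂ P ≤ h)

Intersect : LShape → LShape → Set
Intersect L M = ∃ λ P → P ∈L L × P ∈L M

Adj : ∀ {m} → (Fin m → LShape) → Fin m → Fin m → Set
Adj F u v = ¬ (u ≡ v) × Intersect (F u) (F v)

IsCFColoring : ∀ {m k} → (Fin m → Fin m → Set) → (Fin m → Fin k) → Set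
IsCFColoring {m} A c =
  ∀ v → (∃ λ u → A v u) →
    ∃ λ u → A v u × (∀ w → A v w → c w ≡ c u → w ≡ u)

CFColorableWith : ∀ {m} → (Fin m → Fin m → Set) → ℕ → Set
CFColorableWith A k = Σ (Fin _ → Fin k) λ c → IsCFColoring A c

record GroundedFamily (h : ℚ) (n : ℕ) : Set where
  field
    size     : ℕ
    size≤n   : size ℕ.≤ n
    shape    : Fin size → LShape
    grounded : ∀ i → Grounded h (shape i)
open GroundedFamily public

IG : ∀ {h n} (F : GroundedFamily h n) → Fin (size F) → Fin (size F) → Set
IG F = Adj (shape F)

{-# OPTIONS --safe #-}

-- Lower bound: with m deep vertical segments as points, any interval of them is the
-- exact neighbourhood of some shallow L-shape, and the shallow shapes can be made
-- pairwise disjoint by letting the depth decrease from left to right. A colouring of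
-- m points in which every interval has a uniquely coloured point needs more than
-- log₂ m colours, and m + m² shapes suffice.
--
-- Upper bound (in fact O(log² n)): order the shapes by x-coordinate, and give each shape
-- the level t of the dyadic block of length 2ᵗ⁺¹ at whose middle the x-range of the shape
-- is split. A vertex v is served at the highest level occurring in its neighbourhood, and
-- different levels use disjoint palettes. Within a level, any set S of shapes contains a
-- subset I with |I| ≥ |S| / 2¹⁰ such that no v served there has two or more neighbours in
-- S all of them in I; giving I a colour of its own and repeating with S ∖ I takes O(log n)
-- colours, and the last neighbours of v to be removed consist of a single vertex. The set
-- I is independent in ten acyclic functional graphs, each of which costs a factor of two.
module Submission where

open import Defs
open import Data.Bool as Bool using (Bool; true; false; not; _∧_; if_then_else_)
open import Data.Empty using (⊥; ⊥-elim)
open import Data.Fin as Fin using (Fin; toℕ)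
import Data.Fin.Properties as Finₚ
import Data.Integer as ℤ
import Data.Integer.Properties as ℤₚ
open import Data.List using (List; []; _∷_; length; filter; allFin; upTo)
open import Data.List.Membership.Propositional using (_∈_; find; lose)
import Data.List.Membership.DecPropositional as DecMembership
open import Data.List.Membership.Propositional.Properties using (∈-filter⁺; ∈-filter⁻; ∈-allFin; ∈-upTo⁺)
open import Data.List.Properties using (length-filter; length-tabulate; length-upTo; filter-notAll)
open import Data.List.Relation.Unary.All as All using (All; []; _∷_)
open import Data.List.Relation.Unary.Any using (here; there; any?)
open import Data.Maybe using (Maybe; just; nothing; maybe′)
open import Data.Nat hiding (compare)
open import Data.Nat.Coprimality as Coprime using (1-coprimeTo)
open import Data.Nat.DivMod using (_/_; _%_; m≡m%n+[m/n]*n; m%n<n; m/n*n≤m; m≥n⇒m/n>0)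
open import Data.Nat.Induction using (<-rec)
open import Data.Nat.Logarithm
open import Data.Nat.Properties
open import Data.Nat.Solver using (module +-*-Solver)
open import Data.Product using (Σ; ∃; ∃₂; _×_; _,_; proj₁; proj₂)
open import Data.Product.Relation.Binary.Lex.Strict using (×-Lex; ×-isStrictTotalOrder)
open import Data.Product.Relation.Binary.Pointwise.NonDependent using (Pointwise)
open import Data.Rational as ℚ using (ℚ; mkℚ)
import Data.Rational.Properties as ℚₚ
open import Data.Sum using (_⊎_; inj₁; inj₂; [_,_]′)
open import Data.Unit using (⊤; tt)
open import Function using (_∘_; id; case_of_; flip; _on_)
open import Level using (0ℓ)
open import Relation.Binary as B using (Rel; IsStrictTotalOrder; tri<; tri≈; tri>)
import Relation.Binary.Construct.Flip.EqAndOrd as Flip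
import Relation.Binary.Construct.On as On
open import Relation.Binary.PropositionalEquality
open import Relation.Nullary using (¬_; Dec; yes; no; does; contradiction; ¬?)
open import Relation.Nullary.Decidable using (map′; _×-dec_; _⊎-dec_; _→-dec_)
open import Relation.Unary using (Pred; Decidable)

-- Choosing large independent sets

bit : Bool → ℕ
bit true  = 1
bit false = 0

count : ∀ {V : Set} → (V → Bool) → List V → ℕ
count χ []      = 0
count χ (x ∷ S) = bit (χ x) + count χ S

count-true : ∀ {V : Set} (S : List V) → count (λ _ → true) S ≡ length S
count-true []      = refl
count-true (x ∷ S) = cong suc (count-true S)

outside : ∀ {V : Set} → (V → Bool) → List V → List V
outside χ = filter (λ x → χ x Bool.≟ false)

length-outside : ∀ {V : Set} (χ : V → Bool) S →
  length (outside χ S) + count χ S ≡ length S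
length-outside χ []      = refl
length-outside χ (x ∷ S) with χ x
... | true  = trans (+-suc _ _) (cong suc (length-outside χ S))
... | false = cong suc (length-outside χ S)

count-split : ∀ {V : Set} (χ col : V → Bool) S →
  count χ S ≡ count (λ x → χ x ∧ col x) S + count (λ x → χ x ∧ not (col x)) S
count-split χ col []      = refl
count-split χ col (x ∷ S) with χ x | col x
... | false | _     = count-split χ col S
... | true  | true  = cong suc (count-split χ col S)
... | true  | false = trans (cong suc (count-split χ col S)) (sym (+-suc _ _))

least : ∀ {V : Set} {Q : V → Set} (Q? : Decidable Q) {_≼_ : V → V → Set} →
  B.Total _≼_ → B.Transitive _≼_ → (S : List V) →
  (∃ λ y → y ∈ S × Q y × (∀ {z} → z ∈ S → Q z → y ≼ z)) ⊎ (∀ {z} → z ∈ S → ¬ Q z)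
least Q? total tr [] = inj₂ λ ()
least Q? total tr (x ∷ S) with Q? x | least Q? total tr S
... | no ¬q | inj₂ none = inj₂ λ { (here refl) → ¬q ; (there z∈) → none z∈ }
... | no ¬q | inj₁ (y , y∈ , q , min) =
  inj₁ (y , there y∈ , q , λ { (here refl) qz → contradiction qz ¬q ; (there z∈) → min z∈ })
... | yes q | inj₂ none =
  inj₁ (x , here refl , q , λ { (here refl) _ → [ id , id ]′ (total x x)
                              ; (there z∈) qz → contradiction qz (none z∈) })
... | yes q | inj₁ (y , y∈ , qy , min) with total x y
... | inj₁ x≼y = inj₁ (x , here refl , q , λ { (here refl) _ → [ id , id ]′ (total x x)
                                             ; (there z∈) qz → tr x≼y (min z∈ qz) })
... | inj₂ y≼x = inj₁ (y , there y∈ , qy , λ { (here refl) _ → y≼x ; (there z∈) → min z∈ })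

module _ {V : Set} (f : V → Maybe V) (rank : V → ℕ)
         (rank-f : ∀ {x y} → f x ≡ just y → rank y < rank x) where

  private
    -- The first argument is fuel. Since `f` lowers `rank`, fuel above the rank never runs out, so
    -- the value at `zero` does not influence the final colouring.
    colour : ℕ → V → Bool
    colour zero    x = true
    colour (suc k) x = maybe′ (not ∘ colour k) true (f x)

    colour-stable : ∀ k l x → rank x < k → rank x < l → colour k x ≡ colour l x
    colour-stable (suc k) (suc l) x (s≤s p) (s≤s q) with f x in eq
    ... | nothing = refl
    ... | just y  = cong not (colour-stable k l y (≤-trans (rank-f eq) p) (≤-trans (rank-f eq) q))

  two-colouring : ∃ λ (col : V → Bool) → ∀ {x y} → f x ≡ just y → col x ≡ not (col y)
  two-colouring = (λ x → colour (suc (rank x)) x) , alternate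
    where
    alternate : ∀ {x y} → f x ≡ just y → colour (suc (rank x)) x ≡ not (colour (suc (rank y)) y)
    alternate {x} {y} eq rewrite eq =
      cong not (colour-stable (rank x) (suc (rank y)) y (rank-f eq) ≤-refl)

-- A choice rule sends x to a ≼-least y with Q x y; rank makes it acyclic.
record Choice (V : Set) : Set₁ where
  field
    Q       : V → V → Set
    Q?      : B.Decidable Q
    _≼_     : V → V → Set
    ≼-total : B.Total _≼_
    ≼-trans : B.Transitive _≼_
    rank    : V → ℕ
    rank-<  : ∀ {x y} → Q x y → rank y < rank x

module _ {V : Set} (S : List V) where

  -- A weak form of independence in the graph of the rule: x and its chosen candidate do not both
  -- lie in `χ`. Of the choice only `Q x y` and `y ≼ z` are remembered, which is what the geometric
  -- arguments use, and the property survives shrinking `χ`.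
  Escapes : (V → Bool) → Choice V → Set
  Escapes χ c = ∀ {x z} → z ∈ S → Q x z →
      χ x ≡ false ⊎ (∃ λ y → y ∈ S × Q x y × y ≼ z × χ y ≡ false)
    where open Choice c

  Escapes-∧ : ∀ (χ col : V → Bool) c → Escapes χ c → Escapes (λ x → χ x ∧ col x) c
  Escapes-∧ χ col c esc z∈ q with esc z∈ q
  ... | inj₁ e rewrite e = inj₁ refl
  ... | inj₂ (y , y∈ , qy , le , e) = inj₂ (y , y∈ , qy , le , cong (_∧ col y) e)

  -- The chosen candidate has the opposite colour, so both colour classes are independent; the
  -- larger one keeps at least half of `χ`.
  halve : ∀ χ c → ∃ λ col → count χ S ≤ 2 * count (λ x → χ x ∧ col x) S ×
                            Escapes (λ x → χ x ∧ col x) c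
  halve χ c = pick (≤-total (count (λ x → χ x ∧ not (col x)) S) (count (λ x → χ x ∧ col x) S))
    where
    open Choice c
    best : ∀ x → _
    best x = least (Q? x) ≼-total ≼-trans S
    f : V → Maybe V
    f x = [ just ∘ proj₁ , (λ _ → nothing) ]′ (best x)
    f-< : ∀ {x y} → f x ≡ just y → rank y < rank x
    f-< {x} eq with best x
    f-< refl | inj₁ (_ , _ , q , _) = rank-< q
    f-best : ∀ {x z} → z ∈ S → Q x z → ∃ λ y → f x ≡ just y × y ∈ S × Q x y × y ≼ z
    f-best {x} z∈ q with best x
    ... | inj₁ (y , y∈ , qy , min) = y , refl , y∈ , qy , min z∈ q
    ... | inj₂ none = contradiction q (none z∈)
    alternating = two-colouring f rank f-<
    col = proj₁ alternating

    ∧-false : ∀ b {a} → a ≡ false → b ∧ a ≡ false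
    ∧-false true  e = e
    ∧-false false e = refl

    escape : ∀ (col′ : V → Bool) → (∀ {x y} → f x ≡ just y → col′ x ≡ not (col′ y)) →
             Escapes (λ x → χ x ∧ col′ x) c
    escape col′ alt {x} z∈ q with f-best z∈ q
    ... | y , eq , y∈ , qy , le with col′ y in e | alt eq
    ... | true  | e′ = inj₁ (∧-false (χ x) e′)
    ... | false | _  = inj₂ (y , y∈ , qy , le , ∧-false (χ y) e)

    double : ∀ {a b k} → k ≡ a + b → b ≤ a → k ≤ 2 * a
    double {a} {b} refl b≤a = +-monoʳ-≤ a (≤-trans b≤a (≤-reflexive (sym (+-identityʳ a))))

    pick : _ → ∃ λ col → count χ S ≤ 2 * count (λ x → χ x ∧ col x) S × Escapes (λ x → χ x ∧ col x) c
    pick (inj₁ le) = col , double (count-split χ col S) le , escape col (proj₂ alternating)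
    pick (inj₂ le) = not ∘ col ,
      double (trans (count-split χ col S) (+-comm (count (λ x → χ x ∧ col x) S) _)) le ,
      escape (not ∘ col) (cong not ∘ proj₂ alternating)

  -- One halving per rule; the rules treated before still escape because `χ` only shrinks.
  escape-all : ∀ (cs : List (Choice V)) →
    ∃ λ χ → length S ≤ 2 ^ length cs * count χ S × All (Escapes χ) cs
  escape-all [] = (λ _ → true) , ≤-reflexive (sym (trans (+-identityʳ _) (count-true S))) , []
  escape-all (c ∷ cs) with escape-all cs
  ... | χ , le , all with halve χ c
  ... | col , le′ , esc = (λ x → χ x ∧ col x) , bound , esc ∷ weaken all
    where
    bound : length S ≤ 2 ^ suc (length cs) * count (λ x → χ x ∧ col x) S
    bound = begin
      length S                      ≤⟨ le ⟩
      2 ^ length cs * count χ S     ≤⟨ *-monoʳ-≤ (2 ^ length cs) le′ ⟩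
      2 ^ length cs * (2 * c′)      ≡⟨ *-assoc (2 ^ length cs) 2 c′ ⟨
      2 ^ length cs * 2 * c′        ≡⟨ cong (_* c′) (*-comm (2 ^ length cs) 2) ⟩
      2 ^ suc (length cs) * c′      ∎
      where
      open ≤-Reasoning
      c′ = count (λ x → χ x ∧ col x) S
    weaken : ∀ {ds} → All (Escapes χ) ds → All (Escapes (λ x → χ x ∧ col x)) ds
    weaken []           = []
    weaken (_∷_ {x = d} e es) = Escapes-∧ χ col d e ∷ weaken es

-- Conflict-free colouring by peeling

module Peeling {V : Set} (_≟_ : B.DecidableEquality V) (Served : V → Set)
               (N : V → V → Set) (N? : B.Decidable N) where

  Thin : (V → Bool) → List V → Set
  Thin χ S = ∀ {v x y} → Served v → x ∈ S → N v x → y ∈ S → N v y → x ≢ y →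
             ∃ λ z → z ∈ S × N v z × χ z ≡ false

  UniqueIn : List V → ∀ {k} → (V → Fin k) → V → V → Set
  UniqueIn S c v u = u ∈ S × N v u × (∀ w → w ∈ S → N v w → c w ≡ c u → w ≡ u)

  CF : List V → ℕ → Set
  CF S k = ∃ λ (c : V → Fin k) → ∀ {v u} → Served v → u ∈ S → N v u → ∃ (UniqueIn S c v)

  -- The set `χ` receives a fresh colour. If v has a neighbour in the rest, its unique colour there
  -- stays unique; otherwise thinness leaves v a single neighbour in `S`.
  peel : ∀ {S χ k} → Thin χ S → CF (outside χ S) k → CF S (suc k)
  peel {S} {χ} {k} thin (c , cf) = c′ , cf′
    where
    c′ : V → Fin (suc k)
    c′ u = if χ u then Fin.zero else Fin.suc (c u)

    c′-outside : ∀ {u} → χ u ≡ false → c′ u ≡ Fin.suc (c u)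
    c′-outside e rewrite e = refl

    c′-suc : ∀ {u i} → c′ u ≡ Fin.suc i → χ u ≡ false × c u ≡ i
    c′-suc {u} e with χ u
    c′-suc refl | false = refl , refl

    outside? = λ x → χ x Bool.≟ false

    cf′ : ∀ {v u} → Served v → u ∈ S → N v u → ∃ (UniqueIn S c′ v)
    cf′ {v} {u} sv u∈ nu with any? (N? v) (outside χ S)
    ... | no none = u , u∈ , nu , λ w w∈ nw _ → case w ≟ u of λ where
          (yes eq) → eq
          (no neq) → let z , z∈ , nz , e = thin sv w∈ nw u∈ nu neq in
                     contradiction (lose (∈-filter⁺ outside? z∈ e) nz) none
    ... | yes some with find some
    ... | u₁ , u₁∈ , nu₁ with cf sv u₁∈ nu₁
    ... | u₂ , u₂∈ , nu₂ , uniq with ∈-filter⁻ outside? {xs = S} u₂∈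
    ... | u₂∈S , e₂ = u₂ , u₂∈S , nu₂ , λ w w∈ nw eq →
            let ew , cw = c′-suc (trans eq (c′-outside e₂)) in
            uniq w (∈-filter⁺ outside? w∈ ew) nw cw

  module _ (P : V → Set) (K : ℕ)
           (thin : ∀ S → (∀ {x} → x ∈ S → P x) →
                   ∃ λ χ → length S ≤ K * count χ S × Thin χ S) where

    private
      -- If `q ≤ s`, the removed `i ≥ s / K` elements make up for the `q / K` by which the bound
      -- drops; if `s ≤ q`, the new bound holds even without a removal.
      shrink : ∀ q j s s′ i → s′ + i ≡ s → s ≤ K * i →
               s * K ≤ q * (K + suc j) → s′ * K ≤ q * (K + j)
      shrink q j s s′ i refl s≤Ki bound with ≤-total q s
      ... | inj₁ q≤s = +-cancelʳ-≤ q (s′ * K) (q * (K + j)) (begin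
              s′ * K + q          ≤⟨ +-monoʳ-≤ (s′ * K) (≤-trans q≤s s≤Ki) ⟩
              s′ * K + K * i      ≡⟨ cong (s′ * K +_) (*-comm K i) ⟩
              s′ * K + i * K      ≡⟨ *-distribʳ-+ K s′ i ⟨
              (s′ + i) * K        ≤⟨ bound ⟩
              q * (K + suc j)     ≡⟨ cong (q *_) (+-suc K j) ⟩
              q * suc (K + j)     ≡⟨ *-suc q (K + j) ⟩
              q + q * (K + j)     ≡⟨ +-comm q _ ⟩
              q * (K + j) + q     ∎)
              where open ≤-Reasoning
      ... | inj₂ s≤q = *-mono-≤ (≤-trans (m≤m+n s′ i) s≤q) (m≤m+n K j)

      round : ∀ {S k} (S⊆ : ∀ {x} → x ∈ S → P x) → CF (outside (proj₁ (thin S S⊆)) S) k → CF S (suc k)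
      round {S} S⊆ = peel {S} {proj₁ (thin S S⊆)} (proj₂ (proj₂ (thin S S⊆)))

      outside-P : ∀ {S} χ → (∀ {x} → x ∈ S → P x) → ∀ {x} → x ∈ outside χ S → P x
      outside-P {S} χ S⊆ x∈ = S⊆ (proj₁ (∈-filter⁻ (λ x → χ x Bool.≟ false) {xs = S} x∈))

      single : ∀ S → length S ≤ 1 → CF S 1
      single [] _ = (λ _ → Fin.zero) , λ _ ()
      single (x ∷ []) _ = (λ _ → Fin.zero) ,
        λ { _ (here refl) n → x , here refl , n , λ { _ (here refl) _ _ → refl } }
      single (x ∷ y ∷ S) (s≤s ())

      -- K rounds halve the size: |S| ≤ 2ᵖ (1 + j / K), and each round lowers j by one.
      rounds : .{{_ : NonZero K}} → ∀ p j S → (∀ {x} → x ∈ S → P x) →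
               length S * K ≤ 2 ^ p * (K + j) → CF S (K * p + j + 1)
      rounds zero zero S S⊆ bound = subst (CF S) (sym (cong (_+ 1) (trans (+-identityʳ _) (*-zeroʳ K))))
        (single S (*-cancelʳ-≤ (length S) 1 K
          (≤-trans bound (≤-reflexive (cong (1 *_) (+-identityʳ K))))))
      rounds (suc p) zero S S⊆ bound =
        subst (CF S) (cong (_+ 1) (trans (+-comm (K * p) K) (trans (sym (*-suc K p)) (sym (+-identityʳ _)))))
          (rounds p K S S⊆ (≤-trans bound (≤-reflexive
            (solve 2 (λ q k → (con 2 :* q) :* (k :+ con 0) := q :* (k :+ k)) refl (2 ^ p) K))))
        where open +-*-Solver
      rounds p (suc j) S S⊆ bound =
        subst (CF S) (cong (_+ 1) (sym (+-suc (K * p) j)))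
          (round S⊆ (rounds p j _ (outside-P (proj₁ t) S⊆)
            (shrink (2 ^ p) j (length S) _ (count (proj₁ t) S) (length-outside (proj₁ t) S) (proj₁ (proj₂ t)) bound)))
        where t = thin S S⊆

    cf-peeling : .{{_ : NonZero K}} → ∀ p S → (∀ {x} → x ∈ S → P x) → length S ≤ 2 ^ p → CF S (K * p + 1)
    cf-peeling p S S⊆ bound = subst (CF S) (cong (_+ 1) (+-identityʳ _))
      (rounds p 0 S S⊆ (≤-trans (*-monoˡ-≤ K bound) (≤-reflexive (cong (2 ^ p *_) (sym (+-identityʳ K))))))

-- One level

⌊n/2⌋-lower : ∀ n → ⌊ n /2⌋ + ⌊ n /2⌋ ≤ n
⌊n/2⌋-lower n = ≤-trans (+-monoʳ-≤ ⌊ n /2⌋ (⌊n/2⌋≤⌈n/2⌉ n)) (≤-reflexive (⌊n/2⌋+⌈n/2⌉≡n n))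

⌊n/2⌋-parity : ∀ n → n ≡ ⌊ n /2⌋ + ⌊ n /2⌋ ⊎ n ≡ suc (⌊ n /2⌋ + ⌊ n /2⌋)
⌊n/2⌋-parity zero          = inj₁ refl
⌊n/2⌋-parity (suc zero)    = inj₂ refl
⌊n/2⌋-parity (suc (suc n)) with ⌊n/2⌋-parity n
... | inj₁ e = inj₁ (cong suc (trans (cong suc e) (sym (+-suc ⌊ n /2⌋ _))))
... | inj₂ e = inj₂ (cong (λ k → suc (suc k)) (trans e (sym (+-suc ⌊ n /2⌋ _))))

⌊n/2⌋-upper : ∀ n → n ≤ suc (⌊ n /2⌋ + ⌊ n /2⌋)
⌊n/2⌋-upper n = [ (λ e → m≤n⇒m≤1+n (≤-reflexive e)) , ≤-reflexive ]′ (⌊n/2⌋-parity n)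

-- Abstract, so that 2 ^ rules is never evaluated.
abstract
  rules : ℕ
  rules = 10

  10≡rules : 10 ≡ rules
  10≡rules = refl

module Shapes {m : ℕ} (pos D E : Fin m → ℕ)
    (pos-injective : ∀ {u v} → pos u ≡ pos v → u ≡ v)
    (D-injective   : ∀ {u v} → D u ≡ D v → u ≡ v)
    where

  V : Set
  V = Fin m

  -- The horizontal arm of v crosses the vertical segment of u; E v is the first
  -- position beyond the arm, and D increases with the depth.
  A : V → V → Set
  A v u = pos v < pos u × pos u < E v × D v < D u

  N : V → V → Set
  N v u = A v u ⊎ A u v

  A? : B.Decidable A
  A? v u = (pos v <? pos u) ×-dec (pos u <? E v) ×-dec (D v <? D u)

  N? : B.Decidable N
  N? v u = A? v u ⊎-dec A? u v

  -- `β` stands for the index of the dyadic block at the current scale, `cell` for that of the block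
  -- twice as long. Positions and depths are bounded by `M` so that `M ∸ _` can serve as a
  -- decreasing rank for rules that increase them.
  module AtLevel (M : ℕ) (pos≤M : ∀ v → pos v ≤ M) (D≤M : ∀ v → D v ≤ M)
               (β : ℕ → ℕ) (β-mono : ∀ {p q} → p ≤ q → β p ≤ β q) where

    cell : ℕ → ℕ
    cell p = ⌊ β p /2⌋

    block : V → ℕ
    block u = cell (pos u)

    cell-squeeze : ∀ {p q r} → p ≤ q → q ≤ r → cell p ≡ cell r → cell q ≡ cell p
    cell-squeeze p≤q q≤r eq = ≤-antisym
      (≤-trans (⌊n/2⌋-mono (β-mono q≤r)) (≤-reflexive (sym eq)))
      (⌊n/2⌋-mono (β-mono p≤q))

    -- Distinct blocks with equal halves force `β (pos u)` to be even and `β (E u)` to be its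
    -- successor: the range of u passes from the left half of its cell to the right half.
    InLevel : V → Set
    InLevel u = β (pos u) < β (E u) × cell (pos u) ≡ cell (E u)

    -- No neighbour of v has a higher level, since a range inside one cell is split at this scale or
    -- a finer one.
    Top : V → Set
    Top v = ∀ u → N v u → cell (pos u) ≡ cell (E u)

    Top? : Decidable Top
    Top? v = Finₚ.all? λ u → N? v u →-dec (cell (pos u) ≟ cell (E u))

    β-cancel-< : ∀ {p q} → β p < β q → p < q
    β-cancel-< lt = ≰⇒> λ q≤p → <⇒≱ lt (β-mono q≤p)

    module _ (S : List V) (S⊆ : ∀ {x} → x ∈ S → InLevel x) where

      open DecMembership (Fin._≟_ {m}) using (_∈?_)

      A-block : ∀ {u v} → u ∈ S → A u v → block v ≡ block u
      A-block u∈ (u<v , v<E , _) = cell-squeeze (<⇒≤ u<v) (<⇒≤ v<E) (proj₂ (S⊆ u∈))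

      -- A vertex in the left half of its cell is early, one in the right half is late. For z in `S`
      -- and in the block of v, an early v makes the condition `pos v < E z` of `A z v` automatic, a
      -- late v the condition `pos z < pos v`.
      Early Late : V → Set
      Early v = ∀ u → u ∈ S → block u ≡ block v → pos v < E u
      Late  v = ∀ u → u ∈ S → block u ≡ block v → pos u < pos v

      Early? : Decidable Early
      Early? v = Finₚ.all? λ u → (u ∈? S) →-dec ((block u ≟ block v) →-dec (pos v <? E u))

      Late? : Decidable Late
      Late? v = Finₚ.all? λ u → (u ∈? S) →-dec ((block u ≟ block v) →-dec (pos u <? pos v))

      -- Every member of S straddles the middle of its block.
      early-or-late : ∀ v → Early v ⊎ Late v
      early-or-late v with ⌊n/2⌋-parity (β (pos v))
      ... | inj₁ even = inj₁ λ u u∈ eq → β-cancel-< (begin-strict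
              β (pos v)             ≡⟨ even ⟩
              block v + block v     ≡⟨ cong₂ _+_ eq eq ⟨
              block u + block u     ≤⟨ ⌊n/2⌋-lower (β (pos u)) ⟩
              β (pos u)             <⟨ proj₁ (S⊆ u∈) ⟩
              β (E u)               ∎)
              where open ≤-Reasoning
      ... | inj₂ odd = inj₂ λ u u∈ eq → β-cancel-< (begin-strict
              β (pos u)                  <⟨ proj₁ (S⊆ u∈) ⟩
              β (E u)                    ≤⟨ ⌊n/2⌋-upper (β (E u)) ⟩
              suc (cell (E u) + cell (E u))    ≡⟨ cong (λ j → suc (j + j)) (trans (sym (proj₂ (S⊆ u∈))) eq) ⟩
              suc (block v + block v)    ≡⟨ odd ⟨
              β (pos v)                  ∎)
              where open ≤-Reasoning

      -- The first two rules break pairs of neighbours to the right of a vertex, the next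
      -- two break pairs to its left.
      deeper-left deeper-right leftmost-shallower furthest-shallower : Choice V
      deeper-left = record
        { Q       = λ x y → pos y < pos x × D x < D y
        ; Q?      = λ x y → (pos y <? pos x) ×-dec (D x <? D y)
        ; _≼_     = λ y z → pos z ≤ pos y
        ; ≼-total = λ y z → ≤-total (pos z) (pos y)
        ; ≼-trans = λ p q → ≤-trans q p
        ; rank    = λ x → M ∸ D x
        ; rank-<  = λ {x} {y} (_ , lt) → ∸-monoʳ-< lt (D≤M y)
        }
      deeper-right = record
        { Q       = λ x y → pos x < pos y × D x < D y
        ; Q?      = λ x y → (pos x <? pos y) ×-dec (D x <? D y)
        ; _≼_     = λ y z → pos y ≤ pos z
        ; ≼-total = λ y z → ≤-total (pos y) (pos z)
        ; ≼-trans = ≤-trans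
        ; rank    = λ x → M ∸ D x
        ; rank-<  = λ {x} {y} (_ , lt) → ∸-monoʳ-< lt (D≤M y)
        }
      leftmost-shallower = record
        { Q       = λ x y → block y ≡ block x × D y < D x
        ; Q?      = λ x y → (block y ≟ block x) ×-dec (D y <? D x)
        ; _≼_     = λ y z → pos y ≤ pos z
        ; ≼-total = λ y z → ≤-total (pos y) (pos z)
        ; ≼-trans = ≤-trans
        ; rank    = D
        ; rank-<  = proj₂
        }
      furthest-shallower = record
        { Q       = λ x y → block y ≡ block x × D y < D x
        ; Q?      = λ x y → (block y ≟ block x) ×-dec (D y <? D x)
        ; _≼_     = λ y z → E z ≤ E y
        ; ≼-total = λ y z → ≤-total (E z) (E y)
        ; ≼-trans = λ p q → ≤-trans q p
        ; rank    = D
        ; rank-<  = proj₂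
        }

      -- Together with leftmost-shallower, the next two rules break a pair (b , a) in one
      -- block with b to the left and a to the right of v: if neither shallowest-before nor
      -- leftmost-shallower, applied to a, picks a left neighbour of v, then their values
      -- are a dip and a guard which make a a candidate for next-after-dip at b.
      shallowest-before : Choice V
      shallowest-before = record
        { Q       = λ x y → block y ≡ block x × pos y < pos x
        ; Q?      = λ x y → (block y ≟ block x) ×-dec (pos y <? pos x)
        ; _≼_     = λ y z → D y ≤ D z
        ; ≼-total = λ y z → ≤-total (D y) (D z)
        ; ≼-trans = ≤-trans
        ; rank    = pos
        ; rank-<  = proj₂
        }

      -- Let v be early with b as its only left neighbour. A dip left of v would be a second one, so
      -- a dip pushes e to the right of v. A guard shallower than v would be a second one too, so a
      -- guard makes e deeper than v.
      Dip : V → V → V → Set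
      Dip b e s = s ∈ S × block s ≡ block b × pos b < pos s × pos s < pos e × D s < D b

      Guard : V → V → V → Set
      Guard b e s = s ∈ S × block s ≡ block b × pos s < pos b × D s < D e

      next-after-dip : Choice V
      next-after-dip = record
        { Q       = λ b e → pos b < pos e × ∃ (Dip b e) × ∃ (Guard b e)
        ; Q?      = λ b e → (pos b <? pos e)
            ×-dec Finₚ.any? (λ s → (s ∈? S) ×-dec (block s ≟ block b) ×-dec (pos b <? pos s)
                                   ×-dec (pos s <? pos e) ×-dec (D s <? D b))
            ×-dec Finₚ.any? (λ s → (s ∈? S) ×-dec (block s ≟ block b) ×-dec (pos s <? pos b)
                                   ×-dec (D s <? D e))
        ; _≼_     = λ y z → pos y ≤ pos z
        ; ≼-total = λ y z → ≤-total (pos y) (pos z)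
        ; ≼-trans = ≤-trans
        ; rank    = λ x → M ∸ pos x
        ; rank-<  = λ {x} {y} (lt , _) → ∸-monoʳ-< lt (pos≤M y)
        }

      -- A bridge is a vertex v whose only neighbours in S are b on the left and a on the
      -- right, in different blocks. Its arm leaves its block, so two bridges cannot be
      -- adjacent (they would be served at a higher level); hence the arcs from v to a do
      -- not cross. In a non-crossing family an arc is either the first one arriving at a,
      -- or is determined by b.
      module Bridges (H : V → Set) (H? : Decidable H)
                     (H-half : (∀ {v} → H v → Early v) ⊎ (∀ {v} → H v → Late v)) where

        record Bridge (v b a : V) : Set where
          constructor bridge
          field
            half   : H v
            top    : Top v
            b∈     : b ∈ S
            Abv    : A b v
            a∈     : a ∈ S
            Ava    : A v a
            apart  : block a ≢ block b
            b-only : ∀ z → z ∈ S → A z v → z ≡ b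
            a-only : ∀ z → z ∈ S → A v z → z ≡ a

        Bridge? : ∀ v b a → Dec (Bridge v b a)
        Bridge? v b a = map′
          (λ (h , t , b∈ , Ab , a∈ , Aa , ne , ub , ua) → bridge h t b∈ Ab a∈ Aa ne ub ua)
          (λ (bridge h t b∈ Ab a∈ Aa ne ub ua) → h , t , b∈ , Ab , a∈ , Aa , ne , ub , ua)
          (H? v ×-dec Top? v ×-dec (b ∈? S) ×-dec A? b v ×-dec (a ∈? S) ×-dec A? v a
           ×-dec ¬? (block a ≟ block b)
           ×-dec Finₚ.all? (λ z → (z ∈? S) →-dec (A? z v →-dec (z Fin.≟ b)))
           ×-dec Finₚ.all? (λ z → (z ∈? S) →-dec (A? v z →-dec (z Fin.≟ a))))

        open Bridge

        -- Otherwise a would lie in the cell of v, which is the block of b.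
        bridge-leaves-block : ∀ {v b a} → Bridge v b a → cell (pos v) ≢ cell (E v)
        bridge-leaves-block B eq = apart B
          (trans (cell-squeeze (<⇒≤ (proj₁ (Ava B))) (<⇒≤ (proj₁ (proj₂ (Ava B)))) eq)
                 (A-block (b∈ B) (Abv B)))

        bridges-nonadjacent : ∀ {v b a w b′ a′} → Bridge v b a → Bridge w b′ a′ → ¬ A v w
        bridges-nonadjacent B C Avw = bridge-leaves-block C (top B _ (inj₁ Avw))

        -- If w is deeper than v, the arm of v, which reaches a, meets w, and two bridges are
        -- adjacent. If v is deeper, then a is deeper than w and lies over the arm of w, so w has a
        -- second right neighbour.
        noncrossing : ∀ {v b a w b′ a′} → Bridge v b a → Bridge w b′ a′ →
                      pos v < pos w → pos w < pos a → pos a < pos a′ → ⊥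
        noncrossing {v} {a = a} {w} B C v<w w<a a<a′ with <-cmp (D v) (D w) | Ava B | Ava C
        ... | tri< lt _ _ | _ , a<E , _ | _ = bridges-nonadjacent B C (v<w , <-trans w<a a<E , lt)
        ... | tri≈ _ eq _ | _ | _ = <⇒≢ v<w (cong pos (D-injective eq))
        ... | tri> _ _ gt | _ , _ , dv<da | _ , a′<E , _ =
              <⇒≢ a<a′ (cong pos (a-only C a (a∈ B) (w<a , <-trans a<a′ a′<E , <-trans gt dv<da)))

        -- The arm of b reaches u, so it meets w if b is shallower than w. Otherwise `b′` is
        -- shallower than b and in the same block, hence a left neighbour of u when the bridges are
        -- early and of v when they are late; there b is the only one.
        between : ∀ {v w u b b′ a a′ a″} → Bridge v b a → Bridge w b′ a′ → Bridge u b a″ →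
                  pos v < pos w → pos w < pos u → b′ ≡ b
        between {v} {w} {u} {b} {b′} Bv Bw Bu v<w w<u with <-cmp (D b) (D w)
        ... | tri≈ _ eq _ = contradiction (cong pos (D-injective eq)) (<⇒≢ (<-trans (proj₁ (Abv Bv)) v<w))
        ... | tri< lt _ _ = sym (b-only Bw b (b∈ Bv)
                (<-trans (proj₁ (Abv Bv)) v<w , <-trans w<u (proj₁ (proj₂ (Abv Bu))) , lt))
        ... | tri> _ _ gt = by-half H-half
          where
          b<v = proj₁ (Abv Bv)
          u<E = proj₁ (proj₂ (Abv Bu))
          shallower : D b′ < D b
          shallower = <-trans (proj₂ (proj₂ (Abv Bw))) gt
          blk-w : block w ≡ block b
          blk-w = cell-squeeze (<⇒≤ (<-trans b<v v<w)) (<⇒≤ (<-trans w<u u<E)) (proj₂ (S⊆ (b∈ Bv)))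
          blk-b′ : block b′ ≡ block b
          blk-b′ = trans (sym (A-block (b∈ Bw) (Abv Bw))) blk-w
          by-half : _ → b′ ≡ b
          by-half (inj₁ early) = b-only Bu b′ (b∈ Bw)
            ( <-trans (proj₁ (Abv Bw)) w<u
            , early (half Bu) b′ (b∈ Bw) (trans blk-b′ (sym (A-block (b∈ Bu) (Abv Bu))))
            , <-trans shallower (proj₂ (proj₂ (Abv Bu))))
          by-half (inj₂ late) = b-only Bv b′ (b∈ Bw)
            ( late (half Bv) b′ (b∈ Bw) (trans blk-b′ (sym (A-block (b∈ Bv) (Abv Bv))))
            , <-trans v<w (proj₁ (proj₂ (Abv Bw)))
            , <-trans shallower (proj₂ (proj₂ (Abv Bv))))

        -- Bridges with the same two ends count as one arc, so only a bridge from another `b₀`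
        -- precedes.
        Preceded : V → V → V → Set
        Preceded v b a = ∃₂ λ v₀ b₀ → pos v₀ < pos v × b₀ ≢ b × Bridge v₀ b₀ a

        Preceded? : ∀ v b a → Dec (Preceded v b a)
        Preceded? v b a = Finₚ.any? λ v₀ → Finₚ.any? λ b₀ →
          (pos v₀ <? pos v) ×-dec ¬? (b₀ Fin.≟ b) ×-dec Bridge? v₀ b₀ a

        First Later : V → V → Set
        First a b = ∃ λ v → Bridge v b a × ¬ Preceded v b a
        Later b a = ∃ λ v → Bridge v b a × Preceded v b a

        first-unique : ∀ {a b b′} → First a b → First a b′ → b ≡ b′
        first-unique {a} {b} {b′} (v , B , ¬p) (v′ , B′ , ¬p′) with b Fin.≟ b′ | <-cmp (pos v) (pos v′)
        ... | yes eq | _ = eq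
        ... | no neq | tri< lt _ _ = contradiction (v , b , lt , neq , B) ¬p′
        ... | no neq | tri> _ _ gt = contradiction (v′ , b′ , gt , neq ∘ sym , B′) ¬p
        ... | no neq | tri≈ _ eq _ with pos-injective eq
        ... | refl = b-only B′ b (b∈ B) (Abv B)

        -- If a comes first, either the two arcs cross or a lies in the range of b, against `apart`.
        -- If `a′` comes first, the preceding bridge `v₀` crosses the arc from v when it starts left
        -- of v, and otherwise lies between v and `v′` or equals v, which forces `b₀ ≡ b`.
        later-unique-< : ∀ {v v′ b a a′} → pos v < pos v′ → Bridge v b a →
                         Bridge v′ b a′ → Preceded v′ b a′ → a ≡ a′
        later-unique-< {v} {v′} {b} {a} {a′} v<v′ B B′ (v₀ , b₀ , v₀<v′ , b₀≢b , B₀)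
          with <-cmp (pos a) (pos a′) | pos v′ <? pos a
        ... | tri≈ _ eq _ | _ = pos-injective eq
        ... | tri< a<a′ _ _ | yes v′<a = ⊥-elim (noncrossing B B′ v<v′ v′<a a<a′)
        ... | tri< a<a′ _ _ | no v′≮a = contradiction
              (cell-squeeze (<⇒≤ (<-trans (proj₁ (Abv B)) (proj₁ (Ava B))))
                         (≤-trans (≮⇒≥ v′≮a) (<⇒≤ (proj₁ (proj₂ (Abv B′)))))
                         (proj₂ (S⊆ (b∈ B))))
              (apart B)
        ... | tri> _ _ a′<a | _ with <-cmp (pos v₀) (pos v)
        ... | tri< v₀<v _ _ = ⊥-elim (noncrossing B₀ B v₀<v (<-trans v<v′ (proj₁ (Ava B′))) a′<a)
        ... | tri> _ _ v<v₀ = contradiction (between B B₀ B′ v<v₀ v₀<v′) b₀≢b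
        ... | tri≈ _ eq _ with pos-injective eq
        ... | refl = contradiction (b-only B b₀ (b∈ B₀) (Abv B₀)) b₀≢b

        later-unique : ∀ {b a a′} → Later b a → Later b a′ → a ≡ a′
        later-unique (v , B , p) (v′ , B′ , p′) with <-cmp (pos v) (pos v′)
        ... | tri< lt _ _ = later-unique-< lt B B′ p′
        ... | tri> _ _ gt = sym (later-unique-< gt B′ B p)
        ... | tri≈ _ eq _ with pos-injective eq
        ... | refl = a-only B′ _ (a∈ B) (Ava B)

        -- Candidates are unique, so any total order will do. The first rule leads from a to b and
        -- lowers the position, the second leads from b to a and raises it.
        first-bridge later-bridge : Choice V
        first-bridge = record
          { Q       = First
          ; Q?      = λ a b → Finₚ.any? λ v → Bridge? v b a ×-dec ¬? (Preceded? v b a)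
          ; _≼_     = λ _ _ → ⊤
          ; ≼-total = λ _ _ → inj₁ tt
          ; ≼-trans = λ _ _ → tt
          ; rank    = pos
          ; rank-<  = λ (_ , B , _) → <-trans (proj₁ (Abv B)) (proj₁ (Ava B))
          }
        later-bridge = record
          { Q       = Later
          ; Q?      = λ b a → Finₚ.any? λ v → Bridge? v b a ×-dec Preceded? v b a
          ; _≼_     = λ _ _ → ⊤
          ; ≼-total = λ _ _ → inj₁ tt
          ; ≼-trans = λ _ _ → tt
          ; rank    = λ x → M ∸ pos x
          ; rank-<  = λ {_} {y} (_ , B , _) → ∸-monoʳ-< (<-trans (proj₁ (Abv B)) (proj₁ (Ava B))) (pos≤M y)
          }

        -- The applicable rule can only choose the other end of the arc, so what it puts outside `χ`
        -- is a or b, both neighbours of v.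
        bridge-escapes : ∀ {χ} → Escapes S χ first-bridge → Escapes S χ later-bridge →
          ∀ {v b a} → Bridge v b a → ∃ λ z → z ∈ S × N v z × χ z ≡ false
        bridge-escapes first later {v} {b} {a} B with Preceded? v b a
        ... | no ¬p with first (b∈ B) (v , B , ¬p)
        ...   | inj₁ e = a , a∈ B , inj₁ (Ava B) , e
        ...   | inj₂ (y , _ , q , _ , e) with first-unique q (v , B , ¬p)
        ...     | refl = b , b∈ B , inj₂ (Abv B) , e
        bridge-escapes first later {v} {b} {a} B | yes p with later (a∈ B) (v , B , p)
        ...   | inj₁ e = b , b∈ B , inj₂ (Abv B) , e
        ...   | inj₂ (y , _ , q , _ , e) with later-unique q (v , B , p)
        ...     | refl = a , a∈ B , inj₁ (Ava B) , e

      module EarlyBridges = Bridges Early Early? (inj₁ id)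
      module LateBridges  = Bridges Late  Late?  (inj₂ id)

      choices : List (Choice V)
      choices = deeper-left ∷ deeper-right ∷ leftmost-shallower ∷ furthest-shallower
        ∷ shallowest-before ∷ next-after-dip
        ∷ EarlyBridges.first-bridge ∷ EarlyBridges.later-bridge
        ∷ LateBridges.first-bridge ∷ LateBridges.later-bridge ∷ []

      length-choices : length choices ≡ rules
      length-choices = 10≡rules

      module _ {χ : V → Bool} (escapes : All (Escapes S χ) choices) where

        Escaped : V → Set
        Escaped v = ∃ λ z → z ∈ S × N v z × χ z ≡ false

        private
          left       = All.head escapes
          escapes₁   = All.tail escapes
          right      = All.head escapes₁
          escapes₂   = All.tail escapes₁
          leftmost   = All.head escapes₂
          escapes₃   = All.tail escapes₂
          furthest   = All.head escapes₃
          escapes₄   = All.tail escapes₃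
          shallowest = All.head escapes₄
          escapes₅   = All.tail escapes₄
          dip        = All.head escapes₅

          -- The nearest vertex deeper than x on the side of y lies no further from x than y does.
          -- It is therefore still over the arm of v, and deeper than v.
          right-pair-< : ∀ {v x y} → x ∈ S → A v x → y ∈ S → A v y → D x < D y → Escaped v
          right-pair-< {v} {x} {y} x∈ Ax@(v<x , x<E , dx) y∈ Ay@(v<y , y<E , dy) lt
            with <-cmp (pos x) (pos y)
          ... | tri≈ _ eq _ = contradiction (cong D (pos-injective eq)) (<⇒≢ lt)
          ... | tri< x<y _ _ with right y∈ (x<y , lt)
          ...   | inj₁ e = x , x∈ , inj₁ Ax , e
          ...   | inj₂ (z , z∈ , (x<z , d) , z≤y , e) =
                    z , z∈ , inj₁ (<-trans v<x x<z , ≤-<-trans z≤y y<E , <-trans dx d) , e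
          right-pair-< {v} {x} {y} x∈ Ax@(v<x , x<E , dx) y∈ Ay@(v<y , y<E , dy) lt
              | tri> _ _ y<x with left y∈ (y<x , lt)
          ...   | inj₁ e = x , x∈ , inj₁ Ax , e
          ...   | inj₂ (z , z∈ , (z<x , d) , y≤z , e) =
                    z , z∈ , inj₁ (<-≤-trans v<y y≤z , <-trans z<x x<E , <-trans dx d) , e

          -- Both neighbours lie in the block of v. A vertex shallower than x that starts no later
          -- than y meets an early v; one that reaches at least as far as y meets a late v.
          left-pair-< : ∀ {v x y} → x ∈ S → A x v → y ∈ S → A y v → D y < D x → Escaped v
          left-pair-< {v} {x} {y} x∈ Ax y∈ Ay lt with early-or-late v
          ... | inj₁ early
                with leftmost y∈ (trans (sym (A-block y∈ Ay)) (A-block x∈ Ax) , lt)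
          ...   | inj₁ e = x , x∈ , inj₂ Ax , e
          ...   | inj₂ (z , z∈ , (blk , d) , z≤y , e) = z , z∈ , inj₂
                  ( ≤-<-trans z≤y (proj₁ Ay)
                  , early z z∈ (trans blk (sym (A-block x∈ Ax)))
                  , <-trans d (proj₂ (proj₂ Ax))) , e
          left-pair-< {v} {x} {y} x∈ Ax y∈ Ay lt | inj₂ late
                with furthest y∈ (trans (sym (A-block y∈ Ay)) (A-block x∈ Ax) , lt)
          ...   | inj₁ e = x , x∈ , inj₂ Ax , e
          ...   | inj₂ (z , z∈ , (blk , d) , Ey≤Ez , e) = z , z∈ , inj₂
                  ( late z z∈ (trans blk (sym (A-block x∈ Ax)))
                  , <-≤-trans (proj₁ (proj₂ Ay)) Ey≤Ez
                  , <-trans d (proj₂ (proj₂ Ax))) , e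

          D-apart : ∀ {x y} → x ≢ y → D x < D y ⊎ D y < D x
          D-apart {x} {y} x≢y with <-cmp (D x) (D y)
          ... | tri< lt _ _ = inj₁ lt
          ... | tri≈ _ eq _ = contradiction (D-injective eq) x≢y
          ... | tri> _ _ gt = inj₂ gt

          right-pair : ∀ {v x y} → x ∈ S → A v x → y ∈ S → A v y → x ≢ y → Escaped v
          right-pair x∈ Ax y∈ Ay x≢y =
            [ right-pair-< x∈ Ax y∈ Ay , right-pair-< y∈ Ay x∈ Ax ]′ (D-apart x≢y)

          left-pair : ∀ {v x y} → x ∈ S → A x v → y ∈ S → A y v → x ≢ y → Escaped v
          left-pair x∈ Ax y∈ Ay x≢y =
            [ left-pair-< y∈ Ay x∈ Ax , left-pair-< x∈ Ax y∈ Ay ]′ (D-apart x≢y)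

          <⇒≢V : ∀ {x y} (f : V → ℕ) → f x < f y → x ≢ y
          <⇒≢V f lt refl = <-irrefl refl lt

          -- A late v has no member of `S` from its block to its right, so v is early. The rules at
          -- a give an escaping neighbour of v, or else a dip and a guard for the rule at b.
          same-block : ∀ {v b a} → b ∈ S → A b v → a ∈ S → A v a → block a ≡ block b → Escaped v
          same-block {v} {b} {a} b∈ Ab@(b<v , v<Eb , db) a∈ Aa@(v<a , a<E , da) blk-ab
            with early-or-late v
          ... | inj₂ late =
                contradiction (late a a∈ (trans blk-ab (sym (A-block b∈ Ab)))) (<-asym v<a)
          ... | inj₁ early
                with shallowest b∈ (sym blk-ab , <-trans b<v v<a)
          ...   | inj₁ e = a , a∈ , inj₁ Aa , e
          ...   | inj₂ (z , z∈ , (blk-za , z<a) , dz , e) with <-cmp (pos z) (pos v)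
          ...     | tri≈ _ eq _ = contradiction (pos-injective eq) (<⇒≢V D (≤-<-trans dz db))
          ...     | tri< z<v _ _ = z , z∈ ,
                      inj₂ (z<v , early z z∈ (trans blk-za (trans blk-ab (sym (A-block b∈ Ab)))) , ≤-<-trans dz db) , e
          ...     | tri> _ _ v<z with leftmost b∈ (sym blk-ab , <-trans db da)
          ...       | inj₁ e′ = a , a∈ , inj₁ Aa , e′
          ...       | inj₂ (z′ , z′∈ , (blk-z′a , dz′) , z′≤b , e′) with <-cmp (D z′) (D v)
          ...         | tri≈ _ eq _ = contradiction (D-injective eq) (<⇒≢V pos (≤-<-trans z′≤b b<v))
          ...         | tri< dz′<dv _ _ = z′ , z′∈ , inj₂ (≤-<-trans z′≤b b<v
                          , early z′ z′∈ (trans blk-z′a (trans blk-ab (sym (A-block b∈ Ab)))) , dz′<dv) , e′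
          -- z lies to the right of v and `z′` is deeper than v, so neither is b and the weak
          -- inequalities become strict: z is a dip and `z′` a guard.
          ...         | tri> _ _ dv<dz′ with dip {b} {a} a∈
                          ( <-trans b<v v<a
                          , (z , z∈ , trans blk-za blk-ab , <-trans b<v v<z , z<a
                               , ≤∧≢⇒< dz (λ eq → <⇒≢V pos (<-trans b<v v<z) (sym (D-injective eq))))
                          , (z′ , z′∈ , trans blk-z′a blk-ab
                                , ≤∧≢⇒< z′≤b (λ eq → <⇒≢V D (<-trans db dv<dz′) (sym (pos-injective eq))) , dz′))
          ...           | inj₁ e″ = b , b∈ , inj₂ Ab , e″
          ...           | inj₂ (c , c∈ , (_ , (s , s∈ , blk-s , b<s , s<c , ds) , (g , g∈ , blk-g , g<b , dg)) , c≤a , e″)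
                          with <-cmp (pos s) (pos v) | <-cmp (D g) (D v)
          ...             | tri≈ _ eq _ | _ = contradiction (pos-injective eq) (<⇒≢V D (<-trans ds db))
          ...             | tri< s<v _ _ | _ = left-pair s∈
                              (s<v , early s s∈ (trans blk-s (sym (A-block b∈ Ab))) , <-trans ds db) b∈ Ab (<⇒≢V D ds)
          ...             | _ | tri≈ _ eq _ = contradiction (D-injective eq) (<⇒≢V pos (<-trans g<b b<v))
          ...             | _ | tri< dg<dv _ _ = left-pair g∈
                              (<-trans g<b b<v , early g g∈ (trans blk-g (sym (A-block b∈ Ab))) , dg<dv) b∈ Ab (<⇒≢V pos g<b)
          ...             | tri> _ _ v<s | tri> _ _ dv<dg =
                              c , c∈ , inj₁ (<-trans v<s s<c , ≤-<-trans c≤a a<E , <-trans dv<dg dg) , e″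

          -- Any further neighbour in `S` makes a pair on one side; without one, v is a bridge.
          different-block : ∀ {v b a} → Top v → b ∈ S → A b v → a ∈ S → A v a → block a ≢ block b → Escaped v
          different-block {v} {b} {a} top b∈ Ab a∈ Aa apart
            with Finₚ.any? (λ z → (z ∈? S) ×-dec A? z v ×-dec ¬? (z Fin.≟ b))
               | Finₚ.any? (λ z → (z ∈? S) ×-dec A? v z ×-dec ¬? (z Fin.≟ a))
          ... | yes (z , z∈ , Az , z≢b) | _ = left-pair z∈ Az b∈ Ab z≢b
          ... | _ | yes (z , z∈ , Az , z≢a) = right-pair z∈ Az a∈ Aa z≢a
          ... | no ¬b | no ¬a = by-half escapes (early-or-late v)
            where
            b-only : ∀ z → z ∈ S → A z v → z ≡ b
            b-only z z∈ Az with z Fin.≟ b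
            ... | yes eq = eq
            ... | no neq = contradiction (z , z∈ , Az , neq) ¬b
            a-only : ∀ z → z ∈ S → A v z → z ≡ a
            a-only z z∈ Az with z Fin.≟ a
            ... | yes eq = eq
            ... | no neq = contradiction (z , z∈ , Az , neq) ¬a
            by-half : All (Escapes S χ) choices → Early v ⊎ Late v → Escaped v
            by-half (_ ∷ _ ∷ _ ∷ _ ∷ _ ∷ _ ∷ first ∷ later ∷ _) (inj₁ early) =
              EarlyBridges.bridge-escapes first later
                (EarlyBridges.bridge early top b∈ Ab a∈ Aa apart b-only a-only)
            by-half (_ ∷ _ ∷ _ ∷ _ ∷ _ ∷ _ ∷ _ ∷ _ ∷ first ∷ later ∷ []) (inj₂ late) =
              LateBridges.bridge-escapes first later
                (LateBridges.bridge late top b∈ Ab a∈ Aa apart b-only a-only)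

          both-sides : ∀ {v b a} → Top v → b ∈ S → A b v → a ∈ S → A v a → Escaped v
          both-sides {b = b} {a} top b∈ Ab a∈ Aa with block a ≟ block b
          ... | yes eq = same-block b∈ Ab a∈ Aa eq
          ... | no neq = different-block top b∈ Ab a∈ Aa neq

        thin : Peeling.Thin Fin._≟_ Top N N? χ S
        thin top x∈ (inj₁ Ax) y∈ (inj₁ Ay) x≢y = right-pair x∈ Ax y∈ Ay x≢y
        thin top x∈ (inj₂ Ax) y∈ (inj₂ Ay) x≢y = left-pair x∈ Ax y∈ Ay x≢y
        thin top x∈ (inj₁ Ax) y∈ (inj₂ Ay) x≢y = both-sides top y∈ Ay x∈ Ax
        thin top x∈ (inj₂ Ax) y∈ (inj₁ Ay) x≢y = both-sides top x∈ Ax y∈ Ay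

    thin-subset : ∀ S → (∀ {x} → x ∈ S → InLevel x) →
      ∃ λ χ → length S ≤ 2 ^ rules * count χ S × Peeling.Thin Fin._≟_ Top N N? χ S
    thin-subset S S⊆ =
      let χ , bound , esc = escape-all S (choices S S⊆) in
      χ , subst (λ k → length S ≤ 2 ^ k * count χ S) (length-choices S S⊆) bound , thin S S⊆ esc

-- Combining the levels

-- blk t p is the index of the dyadic block of length 2ᵗ containing p.
blk : ℕ → ℕ → ℕ
blk zero    p = p
blk (suc t) p = ⌊ blk t p /2⌋

blk-mono : ∀ t {p q} → p ≤ q → blk t p ≤ blk t q
blk-mono zero    le = le
blk-mono (suc t) le = ⌊n/2⌋-mono (blk-mono t le)

blk-< : ∀ t s {p} → p < 2 ^ (t + s) → blk t p < 2 ^ s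
blk-< zero    s lt = lt
blk-< (suc t) s {p} lt = ≰⇒> λ 2^s≤h → <⇒≱ below (begin
    2 * 2 ^ s                   ≡⟨ cong (2 ^ s +_) (+-identityʳ (2 ^ s)) ⟩
    2 ^ s + 2 ^ s               ≤⟨ +-mono-≤ 2^s≤h 2^s≤h ⟩
    ⌊ blk t p /2⌋ + ⌊ blk t p /2⌋ ≤⟨ ⌊n/2⌋-lower (blk t p) ⟩
    blk t p                     ∎)
  where
  open ≤-Reasoning
  below : blk t p < 2 ^ suc s
  below = blk-< t (suc s) (subst (λ k → p < 2 ^ k) (sym (+-suc t s)) lt)

blk-top : ∀ L {p} → p < 2 ^ L → blk L p ≡ 0
blk-top L lt = n<1⇒n≡0 (blk-< L 0 (subst (λ k → _ < 2 ^ k) (sym (+-identityʳ L)) lt))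

blk-coarser : ∀ {s t p q} → s ≤′ t → blk s p ≡ blk s q → blk t p ≡ blk t q
blk-coarser ≤′-refl       eq = eq
blk-coarser (≤′-step s≤t) eq = cong ⌊_/2⌋ (blk-coarser s≤t eq)

split-level : ∀ k {p q} → p ≢ q → blk k p ≡ blk k q →
              ∃ λ t → t < k × blk t p ≢ blk t q × blk (suc t) p ≡ blk (suc t) q
split-level zero    p≢q eq = contradiction eq p≢q
split-level (suc k) {p} {q} p≢q eq with blk k p ≟ blk k q
... | no neq  = k , ≤-refl , neq , eq
... | yes eq′ = let t , t<k , r = split-level k p≢q eq′ in t , m≤n⇒m≤1+n t<k , r

module Assembly {m : ℕ} (pos D E : Fin m → ℕ)
    (pos-injective : ∀ {u v} → pos u ≡ pos v → u ≡ v)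
    (D-injective   : ∀ {u v} → D u ≡ D v → u ≡ v)
    (L : ℕ) (m≤2^L : m ≤ 2 ^ L)
    (pos<E : ∀ u → pos u < E u) (E<2^L : ∀ u → E u < 2 ^ L) (D<2^L : ∀ u → D u < 2 ^ L)
    where

  open Shapes pos D E pos-injective D-injective

  private
    pos<2^L : ∀ u → pos u < 2 ^ L
    pos<2^L u = <-trans (pos<E u) (E<2^L u)

    module At (t : ℕ) = AtLevel (2 ^ L) (<⇒≤ ∘ pos<2^L) (<⇒≤ ∘ D<2^L) (blk t) (blk-mono t)

    split : ∀ u → _
    split u = split-level L (<⇒≢ (pos<E u))
      (trans (blk-top L (pos<2^L u)) (sym (blk-top L (E<2^L u))))

    level : Fin m → Fin L
    level u = Fin.fromℕ< (proj₁ (proj₂ (split u)))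

    level-InLevel : ∀ u → At.InLevel (toℕ (level u)) u
    level-InLevel u with split u
    ... | t , t<L , neq , eq rewrite Finₚ.toℕ-fromℕ< t<L =
      ≤∧≢⇒< (blk-mono t (<⇒≤ (pos<E u))) neq , eq

    class : Fin L → List (Fin m)
    class t = filter (λ u → level u Fin.≟ t) (allFin m)

    class-InLevel : ∀ {t x} → x ∈ class t → At.InLevel (toℕ t) x
    class-InLevel {t} {x} x∈ with ∈-filter⁻ (λ u → level u Fin.≟ t) {xs = allFin m} x∈
    ... | _ , refl = level-InLevel x

    abstract
      class-cf : ∀ t → Peeling.CF Fin._≟_ (At.Top (toℕ t)) N N? (class t) (2 ^ rules * L + 1)
      class-cf t = Peeling.cf-peeling Fin._≟_ (At.Top (toℕ t)) N N? (At.InLevel (toℕ t)) (2 ^ rules)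
        (At.thin-subset (toℕ t)) {{m^n≢0 2 rules}} L (class t) class-InLevel
        (≤-trans (length-filter (λ u → level u Fin.≟ t) (allFin m))
                 (≤-trans (≤-reflexive (length-tabulate id)) m≤2^L))

  colour : Fin m → Fin (L * (2 ^ rules * L + 1))
  colour u = Fin.combine (level u) (proj₁ (class-cf (level u)) u)

  colour-cf : IsCFColoring N colour
  colour-cf v (u₀ , n₀)
    -- The order is reversed, so the least neighbour is one of highest level.
    with least (N? v) {λ y z → toℕ (level z) ≤ toℕ (level y)}
               (λ y z → ≤-total (toℕ (level z)) (toℕ (level y))) (λ p q → ≤-trans q p) (allFin m)
  ... | inj₂ none = contradiction n₀ (none (∈-allFin u₀))
  ... | inj₁ (u , _ , nu , highest)
    with proj₂ (class-cf (level u)) {v} {u}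
           -- Every neighbour w has level at most that of u, so its range lies in one block at the
           -- coarser scale: v is `Top` at the level of u.
           (λ w nw → blk-coarser (≤⇒≤′ (s≤s (highest (∈-allFin w) nw))) (proj₂ (level-InLevel w)))
           (∈-filter⁺ (λ w → level w Fin.≟ level u) (∈-allFin u) refl) nu
  ... | u′ , u′∈ , nu′ , unique = u′ , nu′ , only
    where
    level-u′ : level u′ ≡ level u
    level-u′ = proj₂ (∈-filter⁻ (λ w → level w Fin.≟ level u) {xs = allFin m} u′∈)
    only : ∀ w → N v w → colour w ≡ colour u′ → w ≡ u′
    only w nw eq with Finₚ.combine-injective (level w) _ (level u′) _ eq
    ... | lw , cw = unique w (∈-filter⁺ (λ w → level w Fin.≟ level u) (∈-allFin w) (trans lw level-u′)) nw
      (subst (λ t → proj₁ (class-cf t) w ≡ proj₁ (class-cf t) u′) level-u′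
        (subst (λ t → proj₁ (class-cf t) w ≡ proj₁ (class-cf (level u′)) u′) lw cw))

-- Grounded L-shapes

count-mono : ∀ {V : Set} {P R : Pred V 0ℓ} (P? : Decidable P) (R? : Decidable R) →
  (∀ {x} → P x → R x) → ∀ S → count (does ∘ P?) S ≤ count (does ∘ R?) S
count-mono P? R? P⇒R []      = z≤n
count-mono P? R? P⇒R (x ∷ S) with P? x | R? x
... | yes p | yes _ = s≤s (count-mono P? R? P⇒R S)
... | yes p | no ¬r = contradiction (P⇒R p) ¬r
... | no _  | yes _ = m≤n⇒m≤1+n (count-mono P? R? P⇒R S)
... | no _  | no _  = count-mono P? R? P⇒R S

count-mono-< : ∀ {V : Set} {P R : Pred V 0ℓ} (P? : Decidable P) (R? : Decidable R) →
  (∀ {x} → P x → R x) → ∀ {y S} → y ∈ S → ¬ P y → R y → count (does ∘ P?) S < count (does ∘ R?) S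
count-mono-< P? R? P⇒R {y} {S = x ∷ S} (here refl) ¬p r with P? x | R? x
... | yes p | _     = contradiction p ¬p
... | no _  | yes _ = s≤s (count-mono P? R? P⇒R S)
... | no _  | no ¬r = contradiction r ¬r
count-mono-< P? R? P⇒R {S = x ∷ S} (there y∈) ¬p r with P? x | R? x
... | yes p | yes _ = s≤s (count-mono-< P? R? P⇒R y∈ ¬p r)
... | yes p | no ¬r = contradiction (P⇒R p) ¬r
... | no _  | yes _ = m≤n⇒m≤1+n (count-mono-< P? R? P⇒R y∈ ¬p r)
... | no _  | no _  = count-mono-< P? R? P⇒R y∈ ¬p r

count≤length : ∀ {V : Set} (χ : V → Bool) S → count χ S ≤ length S
count≤length χ []      = z≤n
count≤length χ (x ∷ S) with χ x
... | true  = s≤s (count≤length χ S)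
... | false = m≤n⇒m≤1+n (count≤length χ S)

count≤m : ∀ {m} (χ : Fin m → Bool) → count χ (allFin m) ≤ m
count≤m χ = ≤-trans (count≤length χ (allFin _)) (≤-reflexive (length-tabulate id))

module Rank {m} {_≈_ _≺_ : Rel (Fin m) 0ℓ} (isSTO : IsStrictTotalOrder _≈_ _≺_)
            (≈⇒≡ : ∀ {i j} → i ≈ j → i ≡ j) where

  open IsStrictTotalOrder isSTO using (compare; irrefl; module Eq)
    renaming (trans to ≺-trans; _<?_ to _≺?_)

  rank : Fin m → ℕ
  rank i = count (does ∘ (_≺? i)) (allFin m)

  rank-mono : ∀ {i j} → i ≺ j → rank i < rank j
  rank-mono {i} {j} i≺j =
    count-mono-< (_≺? i) (_≺? j) (λ k≺i → ≺-trans k≺i i≺j) (∈-allFin i) (irrefl Eq.refl) i≺j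

  rank-cancel : ∀ {i j} → rank i < rank j → i ≺ j
  rank-cancel {i} {j} lt with compare i j
  ... | tri< i≺j _ _ = i≺j
  ... | tri> _ _ j≺i = contradiction (rank-mono j≺i) (<-asym lt)
  ... | tri≈ _ i≈j _ with ≈⇒≡ i≈j
  ... | refl = contradiction lt (<-irrefl refl)

  rank-injective : ∀ {i j} → rank i ≡ rank j → i ≡ j
  rank-injective {i} {j} eq with compare i j
  ... | tri< i≺j _ _ = contradiction eq (<⇒≢ (rank-mono i≺j))
  ... | tri≈ _ i≈j _ = ≈⇒≡ i≈j
  ... | tri> _ _ j≺i = contradiction (sym eq) (<⇒≢ (rank-mono j≺i))

  rank-total : ∀ {i j} → i ≢ j → rank i < rank j ⊎ rank j < rank i
  rank-total {i} {j} i≢j with <-cmp (rank i) (rank j)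
  ... | tri< lt _ _ = inj₁ lt
  ... | tri≈ _ eq _ = contradiction (rank-injective eq) i≢j
  ... | tri> _ _ gt = inj₂ gt

intersect-sym : ∀ K M → Intersect K M → Intersect M K
intersect-sym _ _ (P , p , q) = P , q , p

-- A common point on the vertical segment of K forces equal x-coordinates, as M does not start
-- before K. A common point on the arm of K places the start of M within the arm and the bottom of M
-- no higher than it.
intersect⇒ : ∀ K M → x K ℚ.≤ x M → Intersect K M →
             x K ≡ x M ⊎ (x M ℚ.≤ x' K × y₀ M ℚ.≤ y₀ K)
intersect⇒ K M K≤M (P , inj₁ (refl , _) , inj₁ (refl , _))               = inj₁ refl
intersect⇒ K M K≤M (P , inj₁ (refl , _) , inj₂ ((M≤K , _) , _))          = inj₁ (ℚₚ.≤-antisym K≤M M≤K)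
intersect⇒ K M K≤M (P , inj₂ ((_ , M≤x') , refl) , inj₁ (refl , y≤ , _)) = inj₂ (M≤x' , y≤)
intersect⇒ K M K≤M (P , inj₂ ((_ , p≤x') , refl) , inj₂ ((M≤p , _) , y≡)) =
  inj₂ (ℚₚ.≤-trans M≤p p≤x' , ℚₚ.≤-reflexive (sym y≡))

intersect⇐ : ∀ {h} K M → Grounded h K → Grounded h M → x K ℚ.≤ x M →
             x M ℚ.≤ x' K → y₀ M ℚ.≤ y₀ K → Intersect K M
-- The arm of K meets the vertical line of M here; both tops lie on the baseline, so this point is
-- below the top of M.
intersect⇐ K M (top-K , _) (top-M , _) K≤M M≤x' y≤ = (x M , y₀ K)
  , inj₂ ((K≤M , M≤x') , refl)
  , inj₁ (refl , y≤ , subst (y₀ K ℚ.≤_) (trans top-K (sym top-M)) (ℚₚ.<⇒≤ (y₀<y₁ K)))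

module Family {h n} (F : GroundedFamily h n) where

  m = size F
  X Y : Fin m → ℚ
  X = x ∘ shape F
  Y = y₀ ∘ shape F

  -- Ties in x are broken towards smaller depth and ties in depth towards smaller x,
  -- so that adjacency is unchanged.
  _≺ˣ_ _≺ᵈ_ : Rel (Fin m) 0ℓ
  _≺ˣ_ = ×-Lex _≡_ ℚ._<_ (×-Lex _≡_ (flip ℚ._<_) Fin._<_) on (λ i → X i , Y i , i)
  _≺ᵈ_ = ×-Lex _≡_ (flip ℚ._<_) (×-Lex _≡_ ℚ._<_ Fin._<_) on (λ i → Y i , X i , i)

  ≺ˣ-isSTO : IsStrictTotalOrder (Pointwise _≡_ (Pointwise _≡_ _≡_) on (λ i → X i , Y i , i)) _≺ˣ_
  ≺ˣ-isSTO = On.isStrictTotalOrder _ (×-isStrictTotalOrder ℚₚ.<-isStrictTotalOrder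
    (×-isStrictTotalOrder (Flip.isStrictTotalOrder ℚₚ.<-isStrictTotalOrder) Finₚ.<-isStrictTotalOrder))

  ≺ᵈ-isSTO : IsStrictTotalOrder (Pointwise _≡_ (Pointwise _≡_ _≡_) on (λ i → Y i , X i , i)) _≺ᵈ_
  ≺ᵈ-isSTO = On.isStrictTotalOrder _ (×-isStrictTotalOrder (Flip.isStrictTotalOrder ℚₚ.<-isStrictTotalOrder)
    (×-isStrictTotalOrder ℚₚ.<-isStrictTotalOrder Finₚ.<-isStrictTotalOrder))

  ≺ˣ⇒≤ : ∀ {i j} → i ≺ˣ j → X i ℚ.≤ X j
  ≺ˣ⇒≤ (inj₁ lt)       = ℚₚ.<⇒≤ lt
  ≺ˣ⇒≤ (inj₂ (eq , _)) = ℚₚ.≤-reflexive eq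

  ≺ᵈ⇒≥ : ∀ {i j} → i ≺ᵈ j → Y j ℚ.≤ Y i
  ≺ᵈ⇒≥ (inj₁ lt)       = ℚₚ.<⇒≤ lt
  ≺ᵈ⇒≥ (inj₂ (eq , _)) = ℚₚ.≤-reflexive (sym eq)

  -- The two tie-breaking rules agree: at equal depth the depth order falls back on x, and at equal
  -- x as well both orders compare indices.
  ≺ˣ∧≥⇒≺ᵈ : ∀ {i j} → i ≺ˣ j → Y j ℚ.≤ Y i → i ≺ᵈ j
  ≺ˣ∧≥⇒≺ᵈ {i} {j} i≺j Yj≤Yi with ℚₚ.<-cmp (Y j) (Y i) | i≺j
  ... | tri< lt _ _ | _                         = inj₁ lt
  ... | tri> _ _ gt | _                         = contradiction (ℚₚ.≤-<-trans Yj≤Yi gt) (ℚₚ.<-irrefl refl)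
  ... | tri≈ _ eq _ | inj₁ lt                   = inj₂ (sym eq , inj₁ lt)
  ... | tri≈ _ eq _ | inj₂ (_ , inj₁ lt)        = contradiction lt (ℚₚ.<-irrefl eq)
  ... | tri≈ _ eq _ | inj₂ (ex , inj₂ (_ , lt)) = inj₂ (sym eq , inj₂ (ex , lt))

  ≺ˣ∧≡⇒≥ : ∀ {i j} → i ≺ˣ j → X i ≡ X j → Y j ℚ.≤ Y i
  ≺ˣ∧≡⇒≥ (inj₁ lt)                   eq = contradiction lt (ℚₚ.<-irrefl eq)
  ≺ˣ∧≡⇒≥ (inj₂ (_ , inj₁ lt))        _  = ℚₚ.<⇒≤ lt
  ≺ˣ∧≡⇒≥ (inj₂ (_ , inj₂ (ey , _)))  _  = ℚₚ.≤-reflexive (sym ey)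

  module Pos   = Rank ≺ˣ-isSTO (proj₂ ∘ proj₂)
  module Depth = Rank ≺ᵈ-isSTO (proj₂ ∘ proj₂)

  reach? : ∀ i → Decidable (λ j → X j ℚ.≤ x' (shape F i))
  reach? i j = X j ℚ.≤? x' (shape F i)

  -- The shapes starting at or before the right end of i form an initial segment of the position
  -- order, so their number is the first position beyond the arm.
  end : Fin m → ℕ
  end i = count (does ∘ reach? i) (allFin m)

  open IsStrictTotalOrder ≺ˣ-isSTO using (irrefl; module Eq) renaming (_<?_ to _≺ˣ?_)

  reach⇒<end : ∀ {i j} → X j ℚ.≤ x' (shape F i) → Pos.rank j < end i
  reach⇒<end {i} {j} le = count-mono-< (_≺ˣ? j) (reach? i)
    (λ k≺j → ℚₚ.≤-trans (≺ˣ⇒≤ k≺j) le) (∈-allFin j) (irrefl Eq.refl) le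

  <end⇒reach : ∀ {i j} → Pos.rank j < end i → X j ℚ.≤ x' (shape F i)
  <end⇒reach {i} {j} lt with reach? i j
  ... | yes le = le
  ... | no nle = contradiction lt (≤⇒≯ (count-mono (reach? i) (_≺ˣ? j)
          (λ le → inj₁ (ℚₚ.≤-<-trans le (ℚₚ.≰⇒> nle))) (allFin m)))

  open Shapes Pos.rank Depth.rank end Pos.rank-injective Depth.rank-injective using (A; N)

  A⇒intersect : ∀ {u v} → A u v → Intersect (shape F u) (shape F v)
  A⇒intersect {u} {v} (u<v , v<E , du<dv) = intersect⇐ (shape F u) (shape F v) (grounded F u) (grounded F v)
    (≺ˣ⇒≤ (Pos.rank-cancel u<v)) (<end⇒reach {u} {v} v<E) (≺ᵈ⇒≥ (Depth.rank-cancel du<dv))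

  A-irrefl : ∀ {u v} → A u v → u ≢ v
  A-irrefl (u<u , _) refl = <-irrefl refl u<u

  intersect⇒A : ∀ {u v} → Pos.rank u < Pos.rank v → Intersect (shape F u) (shape F v) → A u v
  intersect⇒A {u} {v} u<v I = u<v , reach⇒<end {u} {v} (proj₁ reach) , Depth.rank-mono (≺ˣ∧≥⇒≺ᵈ u≺v (proj₂ reach))
    where
    u≺v = Pos.rank-cancel u<v
    reach : X v ℚ.≤ x' (shape F u) × Y v ℚ.≤ Y u
    reach with intersect⇒ (shape F u) (shape F v) (≺ˣ⇒≤ u≺v) I
    ... | inj₂ r  = r
    -- On a common vertical line the arm of u has positive length and so reaches v; the tie-breaking
    -- puts the shallower shape first.
    ... | inj₁ eq = subst (ℚ._≤ x' (shape F u)) eq (ℚₚ.<⇒≤ (x<x' (shape F u))) , ≺ˣ∧≡⇒≥ u≺v eq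

  N⇒Adj : ∀ {u v} → N u v → IG F u v
  N⇒Adj (inj₁ a) = A-irrefl a , A⇒intersect a
  N⇒Adj {u} {v} (inj₂ a) = A-irrefl a ∘ sym , intersect-sym (shape F v) (shape F u) (A⇒intersect a)

  Adj⇒N : ∀ {u v} → IG F u v → N u v
  Adj⇒N {u} {v} (u≢v , I) with Pos.rank-total u≢v
  ... | inj₁ u<v = inj₁ (intersect⇒A u<v I)
  ... | inj₂ v<u = inj₂ (intersect⇒A v<u (intersect-sym (shape F u) (shape F v) I))

  cf-colourable : ∀ L → n < 2 ^ L → CFColorableWith (IG F) (L * (2 ^ rules * L + 1))
  cf-colourable L n<2^L = colour , λ v (u , adj) →
      let w , nw , unique = colour-cf v (u , Adj⇒N adj) in
      w , N⇒Adj nw , λ z adj-z → unique z (Adj⇒N adj-z)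
    where
    -- Strict, because `end` can take the value `m`.
    m<2^L : m < 2 ^ L
    m<2^L = ≤-<-trans (size≤n F) n<2^L
    open Assembly Pos.rank Depth.rank end Pos.rank-injective Depth.rank-injective L (<⇒≤ m<2^L)
      (λ u → reach⇒<end {u} {u} (ℚₚ.<⇒≤ (x<x' (shape F u))))
      (λ u → ≤-<-trans (count≤m (does ∘ reach? u)) m<2^L)
      (λ u → ≤-<-trans (count≤m _) m<2^L)

-- The upper bound in terms of n

n<2^1+⌊log₂n⌋ : ∀ n → n < 2 ^ suc ⌊log₂ n ⌋
n<2^1+⌊log₂n⌋ n = ≰⇒> λ le →
  <-irrefl refl (≤-trans (≤-reflexive (sym (⌊log₂[2^n]⌋≡n (suc ⌊log₂ n ⌋)))) (⌊log₂⌋-mono-≤ le))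

cf-mono : ∀ {m} {A : Fin m → Fin m → Set} {k l} → k ≤ l → CFColorableWith A k → CFColorableWith A l
cf-mono k≤l (c , cf) = (λ u → Fin.inject≤ (c u) k≤l) , λ v ne →
  let u , a , unique = cf v ne in
  u , a , λ w aw eq → unique w aw (Finₚ.inject≤-injective k≤l k≤l (c w) (c u) eq)

-- With `suc l ≤ 2 * l` the palette size is quadratic in l; the last step relaxes the square to a
-- cube.
palette-bound : ∀ K l → 1 ≤ l → suc l * (K * suc l + 1) ≤ (4 * K + 2) * l ^ 3
palette-bound K l@(suc _) 1≤l = begin
  suc l * (K * suc l + 1)          ≤⟨ *-mono-≤ 1+l≤2l (+-mono-≤ (*-monoʳ-≤ K 1+l≤2l) 1≤l) ⟩
  (2 * l) * (K * (2 * l) + l)      ≡⟨ solve 2 (λ k l → (con 2 :* l) :* (k :* (con 2 :* l) :+ l)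
                                       := (con 4 :* k :+ con 2) :* (l :^ 2)) refl K l ⟩
  (4 * K + 2) * l ^ 2              ≤⟨ *-monoʳ-≤ (4 * K + 2) (^-monoʳ-≤ l (n≤1+n 2)) ⟩
  (4 * K + 2) * l ^ 3              ∎
  where
  open ≤-Reasoning
  open +-*-Solver
  1+l≤2l : suc l ≤ 2 * l
  1+l≤2l = +-mono-≤ 1≤l (≤-reflexive (sym (+-identityʳ l)))

upper-bound : ∀ h → ∃ λ C → ∃ λ n₀ → ∀ n → n₀ ≤ n →
  ∀ (F : GroundedFamily h n) → CFColorableWith (IG F) (C * ⌊log₂ n ⌋ ^ 3)
-- The threshold 2 makes the logarithm at least 1.
upper-bound h = 4 * 2 ^ rules + 2 , 2 , λ n 2≤n F →
  cf-mono (palette-bound (2 ^ rules) ⌊log₂ n ⌋ (⌊log₂⌋-mono-≤ 2≤n))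
    (Family.cf-colourable F (suc ⌊log₂ n ⌋) (n<2^1+⌊log₂n⌋ n))

-- The lower bound

module IntervalColouring (c : ℕ → ℕ) (m : ℕ)
    (unique : ∀ s l → s + l < m →
              ∃ λ a → a ≤ l × (∀ a′ → a′ ≤ l → c (s + a′) ≡ c (s + a) → a′ ≡ a)) where

  -- The uniquely coloured point splits the interval into two parts that avoid its colour; by
  -- induction on the number of colours both have fewer than `2 ^ k` points.
  interval-< : ∀ k cs → length cs ≤ k → ∀ s l → s + l ≤ m →
               (∀ a → a < l → c (s + a) ∈ cs) → l < 2 ^ k
  interval-< k cs le s zero _ _ = m^n>0 2 k
  interval-< zero [] le s (suc l) s+l≤m used with used 0 (s≤s z≤n)
  ... | ()
  interval-< (suc k) cs le s (suc l) s+l≤m used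
    with unique s l (≤-trans (≤-reflexive (sym (+-suc s l))) s+l≤m)
  ... | a , a≤l , uniq = begin
      suc (suc l)                  ≡⟨ cong (λ k → suc (suc k)) (m+[n∸m]≡n a≤l) ⟨
      suc (suc (a + b))            ≡⟨ cong suc (+-suc a b) ⟨
      suc a + suc b                ≤⟨ +-mono-≤ left right ⟩
      2 ^ k + 2 ^ k                ≡⟨ cong (2 ^ k +_) (+-identityʳ (2 ^ k)) ⟨
      2 ^ suc k                    ∎
    where
    open ≤-Reasoning
    b = l ∸ a
    other? = λ y → ¬? (y ≟ c (s + a))
    cs′ = filter other? cs
    le′ : length cs′ ≤ k
    le′ = s≤s⁻¹ (≤-trans (filter-notAll other? cs (lose (used a (s≤s a≤l)) (λ ne → ne refl))) le)
    left : a < 2 ^ k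
    left = interval-< k cs′ le′ s a
      (≤-trans (+-monoʳ-≤ s (m≤n⇒m≤1+n a≤l)) s+l≤m)
      (λ a′ a′<a → ∈-filter⁺ other? (used a′ (<-≤-trans a′<a (m≤n⇒m≤1+n a≤l)))
        (λ eq → <⇒≢ a′<a (uniq a′ (≤-trans (<⇒≤ a′<a) a≤l) eq)))
    shift : ∀ a′ → s + suc a + a′ ≡ s + (suc a + a′)
    shift = +-assoc s (suc a)
    within : ∀ {a′} → a′ ≤ b → suc a + a′ ≤ suc l
    within a′≤b = ≤-trans (+-monoʳ-≤ (suc a) a′≤b) (≤-reflexive (cong suc (m+[n∸m]≡n a≤l)))
    right : b < 2 ^ k
    right = interval-< k cs′ le′ (s + suc a) b
      (≤-trans (≤-reflexive (shift b)) (≤-trans (+-monoʳ-≤ s (within ≤-refl)) s+l≤m))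
      (λ a′ a′<b → subst (λ y → c y ∈ cs′) (sym (shift a′))
        (∈-filter⁺ other? (used (suc a + a′) (≤-trans (s≤s (≤-reflexive (sym (+-suc a a′)))) (within a′<b)))
          (λ eq → <⇒≢ (s≤s (m≤m+n a a′))
            (sym (uniq (suc a + a′)
              (s≤s⁻¹ (≤-trans (s≤s (≤-reflexive (sym (+-suc a a′)))) (within a′<b))) eq)))))

-- Families with integer positions and depths

ι : ℕ → ℚ
ι n = mkℚ (ℤ.+ n) 0 (Coprime.sym (1-coprimeTo n))

ι-mono-≤ : ∀ {m n} → m ≤ n → ι m ℚ.≤ ι n
ι-mono-≤ {m} {n} le = ℚ.*≤* (ℤₚ.*-monoʳ-≤-nonNeg (ℤ.+ 1) (ℤ.+≤+ le))

ι-mono-< : ∀ {m n} → m < n → ι m ℚ.< ι n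
ι-mono-< {m} {n} lt = ℚ.*<* (ℤₚ.*-monoʳ-<-pos (ℤ.+ 1) (ℤ.+<+ lt))

ι-cancel-≤ : ∀ {m n} → ι m ℚ.≤ ι n → m ≤ n
ι-cancel-≤ {m} {n} le = ≮⇒≥ λ lt → ℚₚ.<-irrefl refl (ℚₚ.≤-<-trans le (ι-mono-< lt))

depth-< : ∀ h {d e} → d < e → h ℚ.- ι e ℚ.< h ℚ.- ι d
depth-< h lt = ℚₚ.+-monoʳ-< h (ℚₚ.neg-antimono-< (ι-mono-< lt))

depth-≤ : ∀ h {d e} → d ≤ e → h ℚ.- ι e ℚ.≤ h ℚ.- ι d
depth-≤ h le = ℚₚ.+-monoʳ-≤ h (ℚₚ.neg-antimono-≤ (ι-mono-≤ le))

depth-cancel-≤ : ∀ h {d e} → h ℚ.- ι e ℚ.≤ h ℚ.- ι d → d ≤ e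
depth-cancel-≤ h le = ≮⇒≥ λ lt → ℚₚ.<-irrefl refl (ℚₚ.≤-<-trans le (depth-< h lt))

depth>0 : ∀ h {d} → 0 < d → h ℚ.- ι d ℚ.< h
depth>0 h {d} 0<d = subst (h ℚ.- ι d ℚ.<_) (ℚₚ.+-identityʳ h) (depth-< h 0<d)

module GridFamily (h : ℚ) {s : ℕ} (d r : Fin s → ℕ)
    (0<d : ∀ u → 0 < d u) (p<r : ∀ u → toℕ u < r u) where

  grid-shape : Fin s → LShape
  grid-shape u = record
    { x  = ι (toℕ u)
    ; x' = ι (r u)
    ; y₀ = h ℚ.- ι (d u)
    ; y₁ = h
    ; y₀<y₁ = depth>0 h (0<d u)
    ; x<x'  = ι-mono-< (p<r u)
    }

  grid-grounded : ∀ u → Grounded h (grid-shape u)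
  grid-grounded u = refl , (λ eq → ℚₚ.<-irrefl eq (depth>0 h (0<d u))) , below
    where
    below : ∀ P → P ∈L grid-shape u → proj₂ P ℚ.≤ h
    below P (inj₁ (_ , _ , le)) = le
    below P (inj₂ (_ , refl))   = ℚₚ.<⇒≤ (depth>0 h (0<d u))

  grid-adj⇐ : ∀ {u v} → toℕ u < toℕ v → toℕ v ≤ r u → d u ≤ d v → Adj grid-shape u v
  grid-adj⇐ {u} {v} u<v v≤r du≤dv = (λ { refl → <-irrefl refl u<v }) ,
    intersect⇐ (grid-shape u) (grid-shape v) (grid-grounded u) (grid-grounded v)
      (ι-mono-≤ (<⇒≤ u<v)) (ι-mono-≤ v≤r) (depth-≤ h du≤dv)

  grid-intersect⇒ : ∀ {u v} → toℕ u < toℕ v → Intersect (grid-shape u) (grid-shape v) →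
                    toℕ v ≤ r u × d u ≤ d v
  grid-intersect⇒ {u} {v} u<v I with intersect⇒ (grid-shape u) (grid-shape v) (ι-mono-≤ (<⇒≤ u<v)) I
  ... | inj₁ eq        = contradiction (ι-mono-< u<v) (ℚₚ.<-irrefl eq)
  ... | inj₂ (le , le′) = ι-cancel-≤ le , depth-cancel-≤ h le′

  grid-adj⇒ : ∀ {u v} → Adj grid-shape u v →
    (toℕ u < toℕ v × toℕ v ≤ r u × d u ≤ d v) ⊎ (toℕ v < toℕ u × d v ≤ d u)
  grid-adj⇒ {u} {v} (u≢v , I) with <-cmp (toℕ u) (toℕ v)
  ... | tri< lt _ _ = inj₁ (lt , grid-intersect⇒ lt I)
  ... | tri≈ _ eq _ = contradiction (Finₚ.toℕ-injective eq) u≢v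
  ... | tri> _ _ gt = inj₂ (gt , proj₂ (grid-intersect⇒ gt (intersect-sym (grid-shape u) (grid-shape v) I)))

-- Row i holds the shapes (i , l) for l < m, reaching exactly over the points
-- i , … , i + l, and then the deep shape (i , m), which is the point i.
module LowerBound (h : ℚ) (m : ℕ) where

  s : ℕ
  s = m * suc m

  row : Fin s → Fin m
  row u = proj₁ (Fin.remQuot (suc m) u)

  col : Fin s → ℕ
  col u = toℕ (proj₂ (Fin.remQuot {m} (suc m) u))

  col≤m : ∀ u → col u ≤ m
  col≤m u = s≤s⁻¹ (Finₚ.toℕ<n (proj₂ (Fin.remQuot {m} (suc m) u)))

  position : ∀ u → toℕ u ≡ suc m * toℕ (row u) + col u
  position u = trans (cong toℕ (sym (Finₚ.combine-remQuot {m} (suc m) u)))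
                     (Finₚ.toℕ-combine (row u) (proj₂ (Fin.remQuot {m} (suc m) u)))

  -- The depths `s ∸ toℕ u` decrease from left to right, so an interval shape passes below those to
  -- its right; the points, at depth `suc s`, are deeper than all of them. The arm of an interval
  -- shape ends where the point of row `row u + col u` stands, or would stand beyond the grid.
  depth reach : Fin s → ℕ
  depth u with col u ≟ m
  ... | yes _ = suc s
  ... | no  _ = s ∸ toℕ u
  reach u with col u ≟ m
  ... | yes _ = suc (toℕ u)
  ... | no  _ = suc m * (toℕ (row u) + col u) + m

  depth>0′ : ∀ u → 0 < depth u
  depth>0′ u with col u ≟ m
  ... | yes _ = s≤s z≤n
  ... | no  _ = m<n⇒0<n∸m (Finₚ.toℕ<n u)

  position<reach : ∀ u → toℕ u < reach u
  position<reach u with col u ≟ m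
  ... | yes _ = ≤-refl
  ... | no ne = begin-strict
      toℕ u                               ≡⟨ position u ⟩
      suc m * toℕ (row u) + col u         <⟨ +-monoʳ-< (suc m * toℕ (row u)) (≤∧≢⇒< (col≤m u) ne) ⟩
      suc m * toℕ (row u) + m             ≤⟨ +-monoˡ-≤ m (*-monoʳ-≤ (suc m) (m≤m+n (toℕ (row u)) (col u))) ⟩
      suc m * (toℕ (row u) + col u) + m   ∎
      where open ≤-Reasoning

  open GridFamily h depth reach depth>0′ position<reach public

  shape-at : Fin m → Fin (suc m) → Fin s
  shape-at = Fin.combine

  row-at : ∀ i l → row (shape-at i l) ≡ i
  row-at i l = cong proj₁ (Finₚ.remQuot-combine i l)

  col-at : ∀ i l → col (shape-at i l) ≡ toℕ l
  col-at i l = cong (toℕ ∘ proj₂) (Finₚ.remQuot-combine i l)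

  point : Fin m → Fin s
  point j = shape-at j (Fin.fromℕ m)

  depth-point : ∀ u → col u ≡ m → depth u ≡ suc s
  depth-point u eq with col u ≟ m
  ... | yes _ = refl
  ... | no ne = contradiction eq ne

  depth-interval : ∀ u → col u ≢ m → depth u ≡ s ∸ toℕ u
  depth-interval u ne with col u ≟ m
  ... | yes eq = contradiction eq ne
  ... | no _   = refl

  reach-interval : ∀ u → col u ≢ m → reach u ≡ suc m * (toℕ (row u) + col u) + m
  reach-interval u ne with col u ≟ m
  ... | yes eq = contradiction eq ne
  ... | no _   = refl

  -- The depths rule out other interval shapes on either side and points to the left, whose arms run
  -- below v. For a point to the right, comparing positions amounts to comparing rows.
  neighbour⇒point : ∀ {v u} → col v ≢ m → Adj grid-shape v u →
    col u ≡ m × toℕ (row v) ≤ toℕ (row u) × toℕ (row u) ≤ toℕ (row v) + col v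
  neighbour⇒point {v} {u} v-int adj = by-depth (col u ≟ m) (grid-adj⇒ adj)
    where
    open ≤-Reasoning
    by-depth : Dec (col u ≡ m) →
      (toℕ v < toℕ u × toℕ u ≤ reach v × depth v ≤ depth u) ⊎ (toℕ u < toℕ v × depth u ≤ depth v) →
      col u ≡ m × toℕ (row v) ≤ toℕ (row u) × toℕ (row u) ≤ toℕ (row v) + col v
    by-depth (yes eq) (inj₁ (v<u , u≤r , _)) = eq , lower , upper
      where
      lower : toℕ (row v) ≤ toℕ (row u)
      lower = s≤s⁻¹ (*-cancelˡ-< (suc m) (toℕ (row v)) (suc (toℕ (row u))) (begin-strict
        suc m * toℕ (row v)             ≤⟨ m≤m+n _ (col v) ⟩
        suc m * toℕ (row v) + col v     ≡⟨ position v ⟨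
        toℕ v                           <⟨ v<u ⟩
        toℕ u                           ≡⟨ position u ⟩
        suc m * toℕ (row u) + col u     ≤⟨ +-monoʳ-≤ (suc m * toℕ (row u)) (m≤n⇒m≤1+n (col≤m u)) ⟩
        suc m * toℕ (row u) + suc m     ≡⟨ +-comm (suc m * toℕ (row u)) (suc m) ⟩
        suc m + suc m * toℕ (row u)     ≡⟨ *-suc (suc m) (toℕ (row u)) ⟨
        suc m * suc (toℕ (row u))       ∎))
      upper : toℕ (row u) ≤ toℕ (row v) + col v
      upper = *-cancelˡ-≤ (suc m) (+-cancelʳ-≤ m _ _ (begin
        suc m * toℕ (row u) + m               ≡⟨ cong (suc m * toℕ (row u) +_) eq ⟨
        suc m * toℕ (row u) + col u           ≡⟨ position u ⟨
        toℕ u                                 ≤⟨ u≤r ⟩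
        reach v                               ≡⟨ reach-interval v v-int ⟩
        suc m * (toℕ (row v) + col v) + m     ∎))
    by-depth (yes eq) (inj₂ (_ , du≤dv)) = contradiction
            (subst₂ _≤_ (depth-point u eq) (depth-interval v v-int) du≤dv)
            (<⇒≱ (s≤s (m∸n≤m s (toℕ v))))
    by-depth (no ne) (inj₁ (v<u , _ , dv≤du)) = contradiction
            (subst₂ _≤_ (depth-interval v v-int) (depth-interval u ne) dv≤du)
            (<⇒≱ (∸-monoʳ-< v<u (<⇒≤ (Finₚ.toℕ<n u))))
    by-depth (no ne) (inj₂ (u<v , du≤dv)) = contradiction
            (subst₂ _≤_ (depth-interval u ne) (depth-interval v v-int) du≤dv)
            (<⇒≱ (∸-monoʳ-< u<v (<⇒≤ (Finₚ.toℕ<n v))))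

  point⇒neighbour : ∀ {v u} → col v ≢ m → col u ≡ m → toℕ (row v) ≤ toℕ (row u) →
    toℕ (row u) ≤ toℕ (row v) + col v → Adj grid-shape v u
  point⇒neighbour {v} {u} v-int u-pt lower upper = grid-adj⇐ v<u u≤r
    (subst₂ _≤_ (sym (depth-interval v v-int)) (sym (depth-point u u-pt)) (m≤n⇒m≤1+n (m∸n≤m s (toℕ v))))
    where
    open ≤-Reasoning
    v<u : toℕ v < toℕ u
    v<u = begin-strict
      toℕ v                           ≡⟨ position v ⟩
      suc m * toℕ (row v) + col v     <⟨ +-mono-≤-< (*-monoʳ-≤ (suc m) lower) (≤∧≢⇒< (col≤m v) v-int) ⟩
      suc m * toℕ (row u) + m         ≡⟨ cong (suc m * toℕ (row u) +_) u-pt ⟨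
      suc m * toℕ (row u) + col u     ≡⟨ position u ⟨
      toℕ u                           ∎
    u≤r : toℕ u ≤ reach v
    u≤r = begin
      toℕ u                                ≡⟨ position u ⟩
      suc m * toℕ (row u) + col u          ≤⟨ +-mono-≤ (*-monoʳ-≤ (suc m) upper) (col≤m u) ⟩
      suc m * (toℕ (row v) + col v) + m    ≡⟨ reach-interval v v-int ⟨
      reach v                              ∎

  module _ {k} (colour : Fin s → Fin k) (cf : IsCFColoring (Adj grid-shape) colour) where

    -- The colours of the points by row; the default 0 is never consulted, since all intervals stay
    -- below `m`.
    c : ℕ → ℕ
    c j with j <? m
    ... | yes j<m = toℕ (colour (point (Fin.fromℕ< j<m)))
    ... | no _    = 0

    c-point : ∀ u → col u ≡ m → c (toℕ (row u)) ≡ toℕ (colour u)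
    c-point u eq with toℕ (row u) <? m
    ... | no ≮m = contradiction (Finₚ.toℕ<n (row u)) ≮m
    ... | yes <m = cong (toℕ ∘ colour) (trans
            (cong₂ shape-at (Finₚ.fromℕ<-toℕ (row u) <m)
              (Finₚ.toℕ-injective (trans (Finₚ.toℕ-fromℕ m) (sym eq))))
            (Finₚ.combine-remQuot {m} (suc m) u))

    point-at : ∀ {j} → j < m → ∃ λ u → col u ≡ m × toℕ (row u) ≡ j
    point-at j<m = point (Fin.fromℕ< j<m) , trans (col-at _ _) (Finₚ.toℕ-fromℕ m) ,
      trans (cong toℕ (row-at _ _)) (Finₚ.toℕ-fromℕ< j<m)

    -- The neighbourhood of the shape in row i and column l is exactly this interval of points, so
    -- its conflict-free neighbour is the required point.
    unique : ∀ i l → i + l < m →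
             ∃ λ a → a ≤ l × (∀ a′ → a′ ≤ l → c (i + a′) ≡ c (i + a) → a′ ≡ a)
    unique i l i+l<m = from-cf (cf v (let u , _ , _ , adj = point-of 0 z≤n in u , adj))
      where
      l<m : l < m
      l<m = ≤-<-trans (m≤n+m l i) i+l<m
      i<m : i < m
      i<m = ≤-<-trans (m≤m+n i l) i+l<m
      v : Fin s
      v = shape-at (Fin.fromℕ< i<m) (Fin.fromℕ< (m≤n⇒m≤1+n l<m))
      row-v : toℕ (row v) ≡ i
      row-v = trans (cong toℕ (row-at _ _)) (Finₚ.toℕ-fromℕ< i<m)
      col-v : col v ≡ l
      col-v = trans (col-at (Fin.fromℕ< i<m) _) (Finₚ.toℕ-fromℕ< _)
      v-int : col v ≢ m
      v-int eq = <⇒≢ l<m (trans (sym col-v) eq)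

      point-of : ∀ a → a ≤ l → ∃ λ u → col u ≡ m × toℕ (row u) ≡ i + a × Adj grid-shape v u
      point-of a a≤l =
        let u , u-pt , row-u = point-at (≤-<-trans (+-monoʳ-≤ i a≤l) i+l<m) in
        u , u-pt , row-u , point⇒neighbour v-int u-pt
          (subst₂ _≤_ (sym row-v) (sym row-u) (m≤m+n i a))
          (subst₂ _≤_ (sym row-u) (sym (cong₂ _+_ row-v col-v)) (+-monoʳ-≤ i a≤l))

      from-cf : (∃ λ u → Adj grid-shape v u × (∀ w → Adj grid-shape v w → colour w ≡ colour u → w ≡ u)) →
                ∃ λ a → a ≤ l × (∀ a′ → a′ ≤ l → c (i + a′) ≡ c (i + a) → a′ ≡ a)
      from-cf (u , adj-u , uniq) with neighbour⇒point v-int adj-u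
      ... | u-pt , lower , upper = a , a≤l , only
        where
        a = toℕ (row u) ∸ i
        i+a : i + a ≡ toℕ (row u)
        i+a = m+[n∸m]≡n (subst (_≤ toℕ (row u)) row-v lower)
        a≤l : a ≤ l
        a≤l = +-cancelˡ-≤ i a l (≤-trans (≤-reflexive i+a)
                (≤-trans upper (≤-reflexive (cong₂ _+_ row-v col-v))))
        only : ∀ a′ → a′ ≤ l → c (i + a′) ≡ c (i + a) → a′ ≡ a
        only a′ a′≤l eq = +-cancelˡ-≡ i a′ a (begin
            i + a′           ≡⟨ row-w ⟨
            toℕ (row w)      ≡⟨ cong (toℕ ∘ row) (uniq w adj-w same) ⟩
            toℕ (row u)      ≡⟨ i+a ⟨
            i + a            ∎)
          where
          open ≡-Reasoning
          w = proj₁ (point-of a′ a′≤l)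
          w-pt = proj₁ (proj₂ (point-of a′ a′≤l))
          row-w = proj₁ (proj₂ (proj₂ (point-of a′ a′≤l)))
          adj-w = proj₂ (proj₂ (proj₂ (point-of a′ a′≤l)))
          same : colour w ≡ colour u
          same = Finₚ.toℕ-injective (begin
            toℕ (colour w)      ≡⟨ c-point w w-pt ⟨
            c (toℕ (row w))     ≡⟨ cong c row-w ⟩
            c (i + a′)          ≡⟨ eq ⟩
            c (i + a)           ≡⟨ cong c i+a ⟩
            c (toℕ (row u))     ≡⟨ c-point u u-pt ⟩
            toℕ (colour u)      ∎)

    c<k : ∀ {j} → j < m → c j < k
    c<k {j} j<m with j <? m
    ... | yes _  = Finₚ.toℕ<n _
    ... | no j≮m = contradiction j<m j≮m

    few-points : m < 2 ^ k
    few-points = IntervalColouring.interval-< c m unique k (upTo k) (≤-reflexive (length-upTo k))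
      0 m ≤-refl (λ a a<m → ∈-upTo⁺ (c<k a<m))

-- Choosing the number of points from n

2^⌊log₂n⌋≤n : ∀ n → 0 < n → 2 ^ ⌊log₂ n ⌋ ≤ n
2^⌊log₂n⌋≤n = <-rec _ step
  where
  open ≤-Reasoning
  step : ∀ n → (∀ {k} → k < n → 0 < k → 2 ^ ⌊log₂ k ⌋ ≤ k) → 0 < n → 2 ^ ⌊log₂ n ⌋ ≤ n
  step 1 rec _ = ≤-refl
  step n@(suc (suc k)) rec _ = begin
    2 ^ ⌊log₂ n ⌋                    ≡⟨ cong (2 ^_) (m+[n∸m]≡n 1≤log) ⟨
    2 ^ suc (⌊log₂ n ⌋ ∸ 1)          ≡⟨ cong (λ l → 2 ^ suc l) (⌊log₂⌊n/2⌋⌋≡⌊log₂n⌋∸1 n) ⟨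
    2 * 2 ^ ⌊log₂ ⌊ n /2⌋ ⌋          ≤⟨ *-monoʳ-≤ 2 (rec (⌊n/2⌋<n (suc k)) (s≤s z≤n)) ⟩
    2 * ⌊ n /2⌋                      ≡⟨ cong (⌊ n /2⌋ +_) (+-identityʳ ⌊ n /2⌋) ⟩
    ⌊ n /2⌋ + ⌊ n /2⌋                ≤⟨ ⌊n/2⌋-lower n ⟩
    n                                ∎
    where
    1≤log : 1 ≤ ⌊log₂ n ⌋
    1≤log = ⌊log₂⌋-mono-≤ {2} {n} (s≤s (s≤s z≤n))

2^-cancel-< : ∀ t k → 2 ^ t < 2 ^ k → t < k
2^-cancel-< t k lt = ≰⇒> λ k≤t → <⇒≱ lt (^-monoʳ-≤ 2 k≤t)

square-fits : ∀ t → 1 ≤ t → 2 ^ t * suc (2 ^ t) ≤ 2 ^ (t * 3)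
square-fits t 1≤t = begin
  q * suc q          ≤⟨ *-monoʳ-≤ q (+-mono-≤ (m^n>0 2 t) (≤-reflexive (sym (+-identityʳ q)))) ⟩
  q * (2 * q)        ≤⟨ *-monoʳ-≤ q (*-monoˡ-≤ q (^-monoʳ-≤ 2 1≤t)) ⟩
  q * (q * q)        ≡⟨ cong (λ r → q * (q * r)) (*-identityʳ q) ⟨
  q ^ 3              ≡⟨ ^-*-assoc 2 t 3 ⟩
  2 ^ (t * 3)        ∎
  where
  open ≤-Reasoning
  q = 2 ^ t

lower-bound : ∀ h → ∃ λ c → ∃ λ n₀ → ∀ n → n₀ ≤ n →
  Σ (GroundedFamily h n) λ F → ∀ k → CFColorableWith (IG F) k → ⌊log₂ n ⌋ ≤ c * k
-- With `2 ^ t` points the family has at most `2 ^ (t * 3)` shapes, hence t is a third of the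
-- logarithm, and 8 ensures `1 ≤ t`. Then `t < k` gives a logarithm of at most `3 * suc t ≤ 3 * k`.
lower-bound h = 3 , 8 , λ n 8≤n → family n 8≤n , bound n 8≤n
  where
  open ≤-Reasoning
  t : ℕ → ℕ
  t n = ⌊log₂ n ⌋ / 3

  fits : ∀ n → 8 ≤ n → 2 ^ t n * suc (2 ^ t n) ≤ n
  fits n 8≤n = begin
    2 ^ t n * suc (2 ^ t n)    ≤⟨ square-fits (t n) (m≥n⇒m/n>0 (⌊log₂⌋-mono-≤ 8≤n)) ⟩
    2 ^ (t n * 3)              ≤⟨ ^-monoʳ-≤ 2 (m/n*n≤m ⌊log₂ n ⌋ 3) ⟩
    2 ^ ⌊log₂ n ⌋              ≤⟨ 2^⌊log₂n⌋≤n n (≤-trans (s≤s z≤n) 8≤n) ⟩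
    n                          ∎

  family : ∀ n → 8 ≤ n → GroundedFamily h n
  family n 8≤n = record
    { size     = 2 ^ t n * suc (2 ^ t n)
    ; size≤n   = fits n 8≤n
    ; shape    = LowerBound.grid-shape h (2 ^ t n)
    ; grounded = LowerBound.grid-grounded h (2 ^ t n)
    }

  bound : ∀ n (8≤n : 8 ≤ n) k → CFColorableWith (IG (family n 8≤n)) k → ⌊log₂ n ⌋ ≤ 3 * k
  bound n 8≤n k (colour , cf) = begin
    ⌊log₂ n ⌋                            ≡⟨ m≡m%n+[m/n]*n ⌊log₂ n ⌋ 3 ⟩
    ⌊log₂ n ⌋ % 3 + t n * 3              ≤⟨ +-monoˡ-≤ (t n * 3) (<⇒≤ (m%n<n ⌊log₂ n ⌋ 3)) ⟩
    suc (t n) * 3                        ≤⟨ *-monoˡ-≤ 3 (2^-cancel-< (t n) k (LowerBound.few-points h (2 ^ t n) colour cf)) ⟩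
    k * 3                                ≡⟨ *-comm k 3 ⟩
    3 * k                                ∎

theorem2 : (h : ℚ) →
    (∃ λ c → ∃ λ N → ∀ n → N ≤ n →
    Σ (GroundedFamily h n) λ F →
    ∀ k → CFColorableWith (IG F) k → ⌊log₂ n ⌋ ≤ c * k)
    ×
    (∃ λ C → ∃ λ N → ∀ n → N ≤ n →
    ∀ (F : GroundedFamily h n) → CFColorableWith (IG F) (C * ⌊log₂ n ⌋ ^ 3))
theorem2 h = lower-bound h , upper-bound h
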